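{- Let $q$ be a prime power. Let $H$ be a subgroup of $\mathbb{F}_{q^2}^*$ with index $d\geq 2$. Let $k$ be a nonnegative integer, let $g$ be a generator of the cyclic group $\mathbb{F}_{q^2}^*$, and let $S=\bigcup_{j=0}^k g^j H$. Assume that $S=-S$. Let $X=\operatorname{Cay}(\mathbb{F}_{q^2};S)$. (1) If $d \mid (q+1)$ and $d\geq 6k+2$, then $\omega(X)=q$ and all maximum cliques in $X$ are of the form $a\mathbb{F}_q+b$, where $a\in S$ and $b\in \mathbb{F}_{q^2}$. (2) If $d \nmid (q+1)$, $d\geq 12k+3$, and $q^2-1\geq 2d$, then $\omega(X)\leq q-1$.
   Context: $\mathbb{F}_r$ is the finite field with $r$ elements, $\mathbb{F}_r^*=\mathbb{F}_r\setminus\{0\}$ is its multiplicative group, and $\mathbb{F}_q$ is regarded as the unique subfield of order $q$ of $\mathbb{F}_{q^2}$. Here $-S=\{ -s: s\in S\}$ and $a\mathbb{F}_q+b=\{ax+b: x\in\mathbb{F}_q\}$. For an abelian group $G$ and $S\subseteq G\setminus\{0\}$ with $S=-S$, the Cayley graph $\operatorname{Cay}(G;S)$ has vertex set $G$, with two vertices adjacent if and only if their difference lies in $S$; here $G$ is the additive group of $\mathbb{F}_{q^2}$. A clique is a set of pairwise adjacent vertices, a maximum clique is a clique of maximum size, and the clique number $\omega(X)$ is the size of a maximum clique in $X$. -}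

module Defs where

open import Level using (Level; _⊔_)
open import Algebra.Apartness.Bundles using (HeytingField; module HeytingCommutativeRing)
open import Algebra.Bundles using (AbelianGroup; CommutativeRing)
import Algebra.Properties.Semiring.Exp as Exp
open import Data.Fin.Base using (Fin)
open import Data.List.Base using (List; length)
import Data.List.Membership.Setoid as Membership
import Data.List.Relation.Unary.Unique.Setoid as UniqueSetoid
open import Data.Nat.Base using (ℕ; suc; _≤_)
import Data.Nat.Base as ℕ
open import Data.Nat.Primality using (Prime)
open import Data.Product.Base using (Σ; ∃-syntax; _×_; proj₁)
open import Function.Bundles using (Inverse)
open import Relation.Binary.Bundles using (Setoid)
import Relation.Binary.Construct.On as On
open import Relation.Binary.Core using (Rel)
open import Relation.Binary.Definitions using (_Respects_)
open import Relation.Binary.PropositionalEquality using (_≡_)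
import Relation.Binary.PropositionalEquality as ≡
open import Relation.Unary using (Pred)
open import Relation.Unary.Relation.Binary.Equality using (≐-setoid)

private
  variable
    a ℓ r p : Level

IsPrimePower : ℕ → Set
IsPrimePower q = ∃[ p ] ∃[ n ] Prime p × 1 ≤ n × q ≡ p ℕ.^ n

HasSize : Setoid a ℓ → ℕ → Set (a ⊔ ℓ)
HasSize A n = Inverse A (≡.setoid (Fin n))

subsetoid : (A : Setoid a ℓ) → Pred (Setoid.Carrier A) p → Setoid (a ⊔ p) ℓ
subsetoid A P = On.setoid {B = Σ (Setoid.Carrier A) P} A proj₁

-- Meant for S = -S with 0 ∉ S, when this relation is symmetric and
-- irreflexive, i.e. the adjacency relation of a simple graph on G.
Cay : (G : AbelianGroup a ℓ) → Pred (AbelianGroup.Carrier G) p →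
      Rel (AbelianGroup.Carrier G) p
Cay G S x y = S (x ∙ y ⁻¹)
  where open AbelianGroup G

-- A graph is given by a setoid of vertices and an adjacency relation.  A
-- finite set of vertices is a repetition-free list, considered through its
-- membership predicate; its size is its length.
module Cliques (V : Setoid a ℓ) (_~_ : Rel (Setoid.Carrier V) r) where

  open Setoid V using (Carrier; _≉_)
  open Membership V using (_∈_)
  open UniqueSetoid V using (Unique)

  IsClique : List Carrier → Set (a ⊔ ℓ ⊔ r)
  IsClique xs = Unique xs × (∀ {x y} → x ∈ xs → y ∈ xs → x ≉ y → x ~ y)

  IsMaximumClique : List Carrier → Set (a ⊔ ℓ ⊔ r)
  IsMaximumClique xs = IsClique xs × (∀ ys → IsClique ys → length ys ≤ length xs)

  IsCliqueNumber : ℕ → Set (a ⊔ ℓ ⊔ r)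
  IsCliqueNumber w = ∃[ xs ] IsMaximumClique xs × length xs ≡ w

-- The fields below are used only when finite.  Equality is then decidable,
-- x # y and x ≉ y are equivalent, and F is a field in the usual sense (0# ≉ 1#
-- follows from the irreflexivity of _#_).
module FieldNotions {c ℓ₁ ℓ₂} (F : HeytingField c ℓ₁ ℓ₂) where

  commutativeRing : CommutativeRing c ℓ₁
  commutativeRing =
    HeytingCommutativeRing.commutativeRing (HeytingField.heytingCommutativeRing F)

  open CommutativeRing commutativeRing public
    using (Carrier; setoid; +-abelianGroup)
  open CommutativeRing commutativeRing
    using (_≈_; _≉_; _+_; _*_; -_; 0#; 1#; semiring)
  open Membership setoid public using (_∈_)
  open Exp semiring public using (_^_)

  record IsSubfield (K : Pred Carrier p) : Set (c ⊔ ℓ₁ ⊔ p) where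
    field
      resp       : K Respects _≈_
      0-mem      : K 0#
      1-mem      : K 1#
      +-closed   : ∀ {x y} → K x → K y → K (x + y)
      neg-closed : ∀ {x} → K x → K (- x)
      *-closed   : ∀ {x y} → K x → K y → K (x * y)
      inv-closed : ∀ {x y} → K x → x * y ≈ 1# → K y

  record IsSubgroup* (H : Pred Carrier p) : Set (c ⊔ ℓ₁ ⊔ p) where
    field
      resp       : H Respects _≈_
      nonzero    : ∀ {x} → H x → x ≉ 0#
      1-mem      : H 1#
      *-closed   : ∀ {x y} → H x → H y → H (x * y)
      inv-closed : ∀ {x y} → H x → x * y ≈ 1# → H y

  infixr 7 _·_
  _·_ : Carrier → Pred Carrier p → Pred Carrier (c ⊔ ℓ₁ ⊔ p)
  (a · P) y = ∃[ x ] P x × y ≈ a * x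

  neg : Pred Carrier p → Pred Carrier (c ⊔ ℓ₁ ⊔ p)
  neg P y = ∃[ x ] P x × y ≈ - x

  -- The set aP + b.
  affine : Carrier → Pred Carrier p → Carrier → Pred Carrier (c ⊔ ℓ₁ ⊔ p)
  affine a P b y = ∃[ x ] P x × y ≈ a * x + b

  -- The quotient F*/H: nonzero x and y are identified when xH and yH are the
  -- same subset of F.
  cosets : Pred Carrier p → Setoid (c ⊔ ℓ₁) (c ⊔ ℓ₁ ⊔ p)
  cosets {p} H = On.setoid {B = Σ Carrier (_≉ 0#)}
                   (≐-setoid Carrier (c ⊔ ℓ₁ ⊔ p)) (λ x → proj₁ x · H)

  HasIndex* : Pred Carrier p → ℕ → Set (c ⊔ ℓ₁ ⊔ p)
  HasIndex* H d = HasSize (cosets H) d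

  -- Natural exponents suffice for generation, since F* is finite.
  IsGenerator* : Carrier → Set (c ⊔ ℓ₁)
  IsGenerator* g = g ≉ 0# × (∀ x → x ≉ 0# → ∃[ n ] x ≈ g ^ n)

  -- The set H ∪ gH ∪ … ∪ gᵏH.
  cosetUnion : Carrier → Pred Carrier p → ℕ → Pred Carrier (c ⊔ ℓ₁ ⊔ p)
  cosetUnion g H k y = ∃[ j ] j ≤ k × (g ^ j · H) y

module Submission where

-- Let A be a clique with q elements, translated so that 0 ∈ A, and let ξ be an element such that ξ(a − a′) is never
-- a nonzero difference of elements of A.  Then the q² sums b + ξa, with a, b ∈ A, run through the whole field, so
-- their elementary symmetric polynomials eₙ vanish for 0 < n < q² − 1.  As a function of ξ, eₙ is a polynomial of
-- degree at most n.  Differences of elements of A have index in {0, …, k} modulo d, so every ξ whose index lies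
-- strictly between k and d − k is admissible; when there are more than n such ξ, the polynomial is zero.  At ξ = 0
-- and n = qj it equals eⱼ(A)^q by Frobenius, hence eⱼ(A) = 0 for small j.
-- The same applies to the sums b + ξa with a ∈ A and b ∈ B = {0} ∪ {1/a : 0 ≠ a ∈ A}: because
-- 1/a − 1/b = (b − a)/(ab), every ξ whose index lies strictly between k and d − 3k is admissible.  Since eⱼ(B) is
-- proportional to e_{q−1−j}(A), also eⱼ(A) = 0 for j < q − 1 large.  When d ≥ 6k + 2 the two ranges cover
-- 0 < j < q − 1, so ∏ (w + a) = w^q + cw, and A is a line through 0.

open import Defs
open import Algebra.Apartness.Bundles using (HeytingField)
open import Algebra.Bundles using (CommutativeRing)
import Algebra.Properties.CommutativeSemiring.Exp as CommExp
import Algebra.Properties.Ring as RingProperties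
import Algebra.Properties.Semiring.Exp as Exp
import Algebra.Properties.Semiring.Mult as Mult
import Algebra.Solver.Ring.NaturalCoefficients.Default as SemiringSolver
open import Data.Fin.Base using (Fin; zero; suc; toℕ; fromℕ<; combine; remQuot; inject≤)
import Data.Fin.Properties as Fin
open import Data.List.Base using (List; []; _∷_; _++_; length; map; replicate; cartesianProduct; foldr; tabulate; allFin; lookup)
open import Data.List.Membership.Propositional.Properties using (∈-lookup)
import Data.List.Membership.Setoid as Membership
import Data.List.Membership.Setoid.Properties as Membershipₚ
import Data.List.Properties as List
import Data.List.Relation.Binary.Equality.Setoid as ListEquality
import Data.List.Relation.Binary.Permutation.Setoid as Permutation
import Data.List.Relation.Binary.Permutation.Setoid.Properties as PermutationProperties
open import Data.List.Relation.Binary.Pointwise.Base using (Pointwise; []; _∷_)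
open import Data.List.Relation.Unary.All using (All; []; _∷_)
import Data.List.Relation.Unary.All as All
import Data.List.Relation.Unary.All.Properties as Allₚ
open import Data.List.Relation.Unary.AllPairs using (AllPairs; []; _∷_)
import Data.List.Relation.Unary.AllPairs as AllPairs
import Data.List.Relation.Unary.AllPairs.Properties as AllPairsₚ
open import Data.List.Relation.Unary.Any using (Any; here; there)
import Data.List.Relation.Unary.Any as Any
import Data.List.Relation.Unary.Unique.Propositional.Properties as PropUniqueₚ
import Data.List.Relation.Unary.Unique.Setoid as UniqueSetoid
import Data.List.Relation.Unary.Unique.Setoid.Properties as Uniqueₚ
open import Data.Nat.Base using (ℕ; zero; suc; _≤_; _<_; z≤n; s≤s; z<s; s<s; s≤s⁻¹; NonZero)
import Data.Nat.Base as ℕ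
open import Data.Nat.Combinatorics using (_C_; nCk+nC[k+1]≡[n+1]C[k+1]; nC1≡n; nCn≡1; k>n⇒nCk≡0)
open import Data.Nat.Divisibility using (_∣_; _∤_; _∣?_; divides; divides-refl; ∣⇒≤; ∣-trans; 1∣_; m∣m*n; *-cancelˡ-∣; *-monoʳ-∣; m%n≡0⇒n∣m)
open import Data.Nat.DivMod using (_%_; _/_; m≡m%n+[m/n]*n; m%n<n)
open import Data.Nat.Primality using (Prime; euclidsLemma; prime⇒nonZero; prime⇒nonTrivial)
import Data.Nat.Properties as ℕ
import Data.Nat.Tactic.RingSolver as ℕSolver
open import Data.Product.Base using (∃-syntax; Σ; _×_; _,_; proj₁; proj₂)
open import Data.Sum.Base using (_⊎_; inj₁; inj₂; [_,_]′)
open import Function.Base using (_∘_; id)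
open import Function.Bundles using (Inverse)
open import Level using (_⊔_)
open import Relation.Binary.Bundles using (Setoid)
open import Relation.Binary.Core using (Rel)
open import Relation.Binary.Definitions using (Decidable; tri<; tri≈; tri>)
open import Relation.Binary.PropositionalEquality using (_≡_; cong; cong₂; subst; subst₂; module ≡-Reasoning)
import Relation.Binary.PropositionalEquality as ≡
import Relation.Binary.Reasoning.Setoid as SetoidReasoning
open import Relation.Nullary using (¬_; contradiction; yes; no; Dec)
open import Relation.Nullary.Decidable using (map′; _×-dec_; ¬?)
import Relation.Unary as Unary
open import Relation.Unary using (Pred; _≐_)

-- Binomial coefficients modulo a prime

-- The thresholds come from counting scalars. There are d - 2k - 1 indices strictly between k and d
-- - k, and d - 4k - 1 strictly between k and d - 3k; each index accounts for (q² - 1)/d scalars.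
-- When d ≥ 6k + 2 these counts add up to at least d, so there are at least q² - 1 > (q - 1)q
-- scalars in all. Hence if j + j′ = q - 1, either jq is below the first number of scalars or j′q is
-- below the second. The term 3k is k + 2k: a difference a - a′ contributes k, the denominator of a
-- difference of reciprocals 2k. No clique exceeds q elements, because one admissible ξ gives |A|²
-- distinct sums in a field of size q². If d divides q + 1, the nonzero elements of 𝔽q lie in H, so
-- 𝔽q is a clique. For (2), a clique with q elements would be a line, and the nonzero elements of
-- some a𝔽q would lie in S. Their indices form a coset of the subgroup of ℤ/d generated by q + 1; as
-- 2k < d, it fits into {0, ..., k} only if d divides q + 1.

[1+k]*[1+n]C[1+k]≡[1+n]*nCk : ∀ n k → suc k ℕ.* (suc n C suc k) ≡ suc n ℕ.* (n C k)
[1+k]*[1+n]C[1+k]≡[1+n]*nCk n zero = begin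
  suc n C 1 ℕ.+ 0     ≡⟨ ℕ.+-identityʳ _ ⟩
  suc n C 1           ≡⟨ nC1≡n (suc n) ⟩
  suc n               ≡⟨ ℕ.*-identityʳ (suc n) ⟨
  suc n ℕ.* 1         ∎
  where open ≡-Reasoning
[1+k]*[1+n]C[1+k]≡[1+n]*nCk zero (suc k) = begin
  suc (suc k) ℕ.* (1 C suc (suc k))  ≡⟨ cong (suc (suc k) ℕ.*_) (k>n⇒nCk≡0 {1} {suc (suc k)} (s<s z<s)) ⟩
  suc (suc k) ℕ.* 0                  ≡⟨ ℕ.*-zeroʳ (suc (suc k)) ⟩
  0                                  ≡⟨ cong (1 ℕ.*_) (k>n⇒nCk≡0 {0} {suc k} z<s) ⟨
  1 ℕ.* (0 C suc k)                  ∎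
  where open ≡-Reasoning
[1+k]*[1+n]C[1+k]≡[1+n]*nCk (suc n) (suc k) = begin
  suc (suc k) ℕ.* (suc (suc n) C suc (suc k))
    ≡⟨ cong (suc (suc k) ℕ.*_) (nCk+nC[k+1]≡[n+1]C[k+1] (suc n) (suc k)) ⟨
  suc (suc k) ℕ.* (x ℕ.+ y)
    ≡⟨ expand (suc k) x y ⟩
  x ℕ.+ (suc k ℕ.* x ℕ.+ suc (suc k) ℕ.* y)
    ≡⟨ cong (x ℕ.+_) (cong₂ ℕ._+_ ([1+k]*[1+n]C[1+k]≡[1+n]*nCk n k) ([1+k]*[1+n]C[1+k]≡[1+n]*nCk n (suc k))) ⟩
  x ℕ.+ (suc n ℕ.* (n C k) ℕ.+ suc n ℕ.* (n C suc k))
    ≡⟨ cong (x ℕ.+_) (ℕ.*-distribˡ-+ (suc n) (n C k) (n C suc k)) ⟨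
  x ℕ.+ suc n ℕ.* (n C k ℕ.+ n C suc k)
    ≡⟨ cong (λ z → x ℕ.+ suc n ℕ.* z) (nCk+nC[k+1]≡[n+1]C[k+1] n k) ⟩
  suc (suc n) ℕ.* x
    ∎
  where
  open ≡-Reasoning
  x y : ℕ
  x = suc n C suc k
  y = suc n C suc (suc k)
  expand : ∀ k x y → suc k ℕ.* (x ℕ.+ y) ≡ x ℕ.+ (k ℕ.* x ℕ.+ suc k ℕ.* y)
  expand = ℕSolver.solve-∀

p^a∣m*n⇒p^a∣m : ∀ {p} → Prime p → ∀ a m n → ¬ p ∣ n → p ℕ.^ a ∣ m ℕ.* n → p ℕ.^ a ∣ m
p^a∣m*n⇒p^a∣m pr zero m n p∤n _ = 1∣ m
p^a∣m*n⇒p^a∣m {p} pr (suc a) m n p∤n p^[1+a]∣mn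
  with euclidsLemma m n pr (∣-trans (m∣m*n (p ℕ.^ a)) p^[1+a]∣mn)
... | inj₂ p∣n = contradiction p∣n p∤n
... | inj₁ (divides-refl m′) = subst (p ℕ.^ suc a ∣_) (ℕ.*-comm p m′) (*-monoʳ-∣ p (p^a∣m*n⇒p^a∣m pr a m′ n p∤n
        (*-cancelˡ-∣ p {{prime⇒nonZero pr}} (subst (p ℕ.^ suc a ∣_) (reorder m′ p n) p^[1+a]∣mn))))
  where
  reorder : ∀ m p n → m ℕ.* p ℕ.* n ≡ p ℕ.* (m ℕ.* n)
  reorder = ℕSolver.solve-∀

-- By the absorption identity p^a divides i times the binomial coefficient. If p did not divide the
-- coefficient, all of p^a would divide i, which is positive and smaller.
p∣p^aCi : ∀ {p} → Prime p → ∀ a i → 0 < i → i < p ℕ.^ a → p ∣ (p ℕ.^ a C i)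
p∣p^aCi {p} pr a (suc i) _ i<q with p ℕ.^ a in eq
... | suc q with p ∣? (suc q C suc i)
...   | yes p∣C = p∣C
...   | no p∤C = contradiction (∣⇒≤ q∣i) (ℕ.<⇒≱ i<q)
  where
  q∣i : suc q ∣ suc i
  q∣i = subst (_∣ suc i) eq (p^a∣m*n⇒p^a∣m pr a (suc i) (suc q C suc i) p∤C
          (divides (q C i) (≡.trans ([1+k]*[1+n]C[1+k]≡[1+n]*nCk q i)
            (≡.trans (ℕ.*-comm (suc q) (q C i)) (cong ((q C i) ℕ.*_) (≡.sym eq))))))

module RingTheory {c ℓ} (R : CommutativeRing c ℓ) where

  open CommutativeRing R hiding (zero)
    renaming (refl to ≈-refl; sym to ≈-sym; trans to ≈-trans; reflexive to ≈-reflexive)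
  open Exp semiring using (_^_)
  open CommExp commutativeSemiring using (^-distrib-*)
  open Mult semiring using (×-homo-+; ×-comm-*) renaming (_×_ to _×′_)
  open RingProperties ring using (x∙y⁻¹≈ε⇒x≈y)
  open SemiringSolver commutativeSemiring using (solve; _:+_; _:*_; _:=_; con)
  open ListEquality setoid using (_≋_)
  open Permutation setoid using (_↭_; refl; prep; swap; trans)
  open SetoidReasoning setoid

  private
    module Permutationₚ = PermutationProperties setoid

  1^n≈1 : ∀ n → 1# ^ n ≈ 1#
  1^n≈1 zero    = ≈-refl
  1^n≈1 (suc n) = ≈-trans (*-identityˡ _) (1^n≈1 n)

  -- Elementary symmetric polynomials

  e : ℕ → List Carrier → Carrier
  e zero    xs       = 1#
  e (suc n) []       = 0#
  e (suc n) (x ∷ xs) = e (suc n) xs + x * e n xs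

  e-cong : ∀ n {xs ys} → xs ≋ ys → e n xs ≈ e n ys
  e-cong zero    _ = ≈-refl
  e-cong (suc n) [] = ≈-refl
  e-cong (suc n) (x≈y ∷ xs≋ys) = +-cong (e-cong (suc n) xs≋ys) (*-cong x≈y (e-cong n xs≋ys))

  e-resp-↭ : ∀ n {xs ys} → xs ↭ ys → e n xs ≈ e n ys
  e-resp-↭ n (refl xs≋ys) = e-cong n xs≋ys
  e-resp-↭ n (trans p r) = ≈-trans (e-resp-↭ n p) (e-resp-↭ n r)
  e-resp-↭ zero _ = ≈-refl
  e-resp-↭ (suc n) (prep x≈y p) = +-cong (e-resp-↭ (suc n) p) (*-cong x≈y (e-resp-↭ n p))
  e-resp-↭ (suc zero) (swap {xs} {ys} {x} {y} {x′} {y′} x≈x′ y≈y′ p) = begin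
    e 1 xs + y * 1# + x * 1#    ≈⟨ +-cong (+-cong (e-resp-↭ 1 p) (*-congʳ y≈y′)) (*-congʳ x≈x′) ⟩
    e 1 ys + y′ * 1# + x′ * 1#  ≈⟨ solve 3 (λ E X Y → E :+ Y :* con 1 :+ X :* con 1 := E :+ X :* con 1 :+ Y :* con 1) (≈-refl) (e 1 ys) x′ y′ ⟩
    e 1 ys + x′ * 1# + y′ * 1#  ∎
  e-resp-↭ (suc (suc n)) (swap {xs} {ys} {x} {y} {x′} {y′} x≈x′ y≈y′ p) = begin
    e (suc (suc n)) xs + y * e (suc n) xs + x * (e (suc n) xs + y * e n xs)
      ≈⟨ +-cong (+-cong (e-resp-↭ (suc (suc n)) p) (*-cong y≈y′ E₁)) (*-cong x≈x′ (+-cong E₁ (*-cong y≈y′ (e-resp-↭ n p)))) ⟩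
    e (suc (suc n)) ys + y′ * e (suc n) ys + x′ * (e (suc n) ys + y′ * e n ys)
      ≈⟨ solve 5 (λ E₂ E₁ E₀ X Y → E₂ :+ Y :* E₁ :+ X :* (E₁ :+ Y :* E₀) := E₂ :+ X :* E₁ :+ Y :* (E₁ :+ X :* E₀))
           (≈-refl) (e (suc (suc n)) ys) (e (suc n) ys) (e n ys) x′ y′ ⟩
    e (suc (suc n)) ys + x′ * e (suc n) ys + y′ * (e (suc n) ys + x′ * e n ys)
      ∎
    where
    E₁ : e (suc n) xs ≈ e (suc n) ys
    E₁ = e-resp-↭ (suc n) p

  e-overflow : ∀ n xs → length xs < n → e n xs ≈ 0#
  e-overflow (suc n) []       _ = ≈-refl
  e-overflow (suc n) (x ∷ xs) (s≤s |xs|<n) = begin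
    e (suc n) xs + x * e n xs  ≈⟨ +-cong (e-overflow (suc n) xs (ℕ.m<n⇒m<1+n |xs|<n)) (*-congˡ (e-overflow n xs |xs|<n)) ⟩
    0# + x * 0#                ≈⟨ +-identityˡ _ ⟩
    x * 0#                     ≈⟨ zeroʳ x ⟩
    0#                         ∎

  e-0∷ : ∀ n {x} xs → x ≈ 0# → e n (x ∷ xs) ≈ e n xs
  e-0∷ zero    xs x≈0 = ≈-refl
  e-0∷ (suc n) {x} xs x≈0 = begin
    e (suc n) xs + x * e n xs   ≈⟨ +-congˡ (*-congʳ x≈0) ⟩
    e (suc n) xs + 0# * e n xs  ≈⟨ +-congˡ (zeroˡ _) ⟩
    e (suc n) xs + 0#           ≈⟨ +-identityʳ _ ⟩
    e (suc n) xs                ∎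

  e-scale : ∀ n x ys → e n (map (x *_) ys) ≈ x ^ n * e n ys
  e-scale zero    x ys       = ≈-sym (*-identityʳ _)
  e-scale (suc n) x []       = ≈-sym (zeroʳ _)
  e-scale (suc n) x (y ∷ ys) = begin
    e (suc n) (map (x *_) ys) + x * y * e n (map (x *_) ys)
      ≈⟨ +-cong (e-scale (suc n) x ys) (*-congˡ (e-scale n x ys)) ⟩
    x ^ suc n * e (suc n) ys + x * y * (x ^ n * e n ys)
      ≈⟨ solve 5 (λ X Y Z E₁ E₀ → X :* Z :* E₁ :+ X :* Y :* (Z :* E₀) := X :* Z :* (E₁ :+ Y :* E₀))
           (≈-refl) x y (x ^ n) (e (suc n) ys) (e n ys) ⟩
    x ^ suc n * (e (suc n) ys + y * e n ys)
      ∎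

  e₁-translate : ∀ x ys → e 1 (map (x +_) ys) ≈ length ys ×′ x + e 1 ys
  e₁-translate x []       = ≈-sym (+-identityʳ _)
  e₁-translate x (y ∷ ys) = begin
    e 1 (map (x +_) ys) + (x + y) * 1#        ≈⟨ +-congʳ (e₁-translate x ys) ⟩
    length ys ×′ x + e 1 ys + (x + y) * 1#    ≈⟨ solve 4 (λ N E X Y → N :+ E :+ (X :+ Y) :* con 1 := X :+ N :+ (E :+ Y :* con 1))
                                                   (≈-refl) (length ys ×′ x) (e 1 ys) x y ⟩
    x + length ys ×′ x + (e 1 ys + y * 1#)    ∎

  -- The product of all ys, times i of the reciprocals, leaves the product of the complementary j
  -- entries. In polynomial terms this is the reversal of coefficients.
  e-reciprocal : ∀ {ys zs} → Pointwise (λ y z → y * z ≈ 1#) ys zs → ∀ i j → i ℕ.+ j ≡ length ys →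
                 e (length ys) ys * e i zs ≈ e j ys
  e-reciprocal _ zero j ≡.refl = *-identityʳ _
  e-reciprocal {y ∷ ys} {z ∷ zs} (yz≈1 ∷ ps) (suc i) j i+j≡m = begin
    (e (suc m) ys + y * e m ys) * (e (suc i) zs + z * e i zs)
      ≈⟨ *-congʳ (≈-trans (+-congʳ (e-overflow (suc m) ys ℕ.≤-refl)) (+-identityˡ _)) ⟩
    y * e m ys * (e (suc i) zs + z * e i zs)
      ≈⟨ solve 5 (λ Y E A Z B → Y :* E :* (A :+ Z :* B) := Y :* (E :* A) :+ Y :* Z :* (E :* B))
           (≈-refl) y (e m ys) (e (suc i) zs) z (e i zs) ⟩
    y * (e m ys * e (suc i) zs) + y * z * (e m ys * e i zs)
      ≈⟨ +-congˡ (≈-trans (*-congʳ yz≈1) (*-identityˡ _)) ⟩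
    y * (e m ys * e (suc i) zs) + e m ys * e i zs
      ≈⟨ +-cong (lower j (ℕ.suc-injective i+j≡m)) (e-reciprocal ps i j (ℕ.suc-injective i+j≡m)) ⟩
    lowered j + e j ys
      ≈⟨ recombine j ⟩
    e j (y ∷ ys) ∎
    where
    m = length ys
    -- The monomials of `e j (y ∷ ys)` that contain y; for j = 0 there are none.
    lowered : ℕ → Carrier
    lowered zero    = 0#
    lowered (suc j) = y * e j ys
    |zs|≡m : ∀ {ys zs} → Pointwise (λ y z → y * z ≈ 1#) ys zs → length zs ≡ length ys
    |zs|≡m [] = ≡.refl
    |zs|≡m (_ ∷ ps) = cong suc (|zs|≡m ps)
    lower : ∀ j → i ℕ.+ j ≡ m → y * (e m ys * e (suc i) zs) ≈ lowered j
    lower zero i+0≡m = begin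
      y * (e m ys * e (suc i) zs) ≈⟨ *-congˡ (*-congˡ (e-overflow (suc i) zs (s≤s (ℕ.≤-reflexive
                                        (≡.trans (|zs|≡m ps) (≡.trans (≡.sym i+0≡m) (ℕ.+-identityʳ i))))))) ⟩
      y * (e m ys * 0#)           ≈⟨ *-congˡ (zeroʳ _) ⟩
      y * 0#                      ≈⟨ zeroʳ _ ⟩
      0#                          ∎
    lower (suc j) i+j≡m = *-congˡ (e-reciprocal ps (suc i) j (≡.trans (≡.sym (ℕ.+-suc i j)) i+j≡m))
    recombine : ∀ j → lowered j + e j ys ≈ e j (y ∷ ys)
    recombine zero    = +-identityˡ _
    recombine (suc j) = +-comm _ _

  -- Expansion of a product of linear factors

  ∏ : List Carrier → Carrier
  ∏ = foldr _*_ 1#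

  ∏-zero : ∀ {w xs} → Any (λ x → w + x ≈ 0#) xs → ∏ (map (w +_) xs) ≈ 0#
  ∏-zero (here w+x≈0)  = ≈-trans (*-congʳ w+x≈0) (zeroˡ _)
  ∏-zero (there any≈0) = ≈-trans (*-congˡ (∏-zero any≈0)) (zeroʳ _)

  private
    -- The sum of e i · w^(n - i) over i ≤ n. Leaving n independent of the length of the list gives
    -- the recursion `horner-∷`, which mirrors that of `e`.
    horner : Carrier → List Carrier → ℕ → Carrier
    horner w xs zero    = 1#
    horner w xs (suc n) = horner w xs n * w + e (suc n) xs

    horner-∷ : ∀ w x xs n → horner w (x ∷ xs) (suc n) ≈ horner w xs (suc n) + x * horner w xs n
    horner-∷ w x xs zero = ≈-sym (+-assoc _ _ _)
    horner-∷ w x xs (suc n) = begin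
      horner w (x ∷ xs) (suc n) * w + (e (suc (suc n)) xs + x * e (suc n) xs)
        ≈⟨ +-congʳ (*-congʳ (horner-∷ w x xs n)) ⟩
      (horner w xs (suc n) + x * horner w xs n) * w + (e (suc (suc n)) xs + x * e (suc n) xs)
        ≈⟨ solve 6 (λ A X B W E F → (A :+ X :* B) :* W :+ (E :+ X :* F) := A :* W :+ E :+ X :* (B :* W :+ F))
             (≈-refl) (horner w xs (suc n)) x (horner w xs n) w (e (suc (suc n)) xs) (e (suc n) xs) ⟩
      horner w xs (suc (suc n)) + x * horner w xs (suc n) ∎

    ∏-horner : ∀ w xs → ∏ (map (w +_) xs) ≈ horner w xs (length xs)
    ∏-horner w []       = ≈-refl
    ∏-horner w (x ∷ xs) = begin
      (w + x) * ∏ (map (w +_) xs)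
        ≈⟨ *-congˡ (∏-horner w xs) ⟩
      (w + x) * H
        ≈⟨ solve 3 (λ W X H → (W :+ X) :* H := H :* W :+ con 0 :+ X :* H) (≈-refl) w x H ⟩
      H * w + 0# + x * H
        -- One Horner step past the length only multiplies by w, the new coefficient being 0.
        ≈⟨ +-congʳ (+-congˡ (e-overflow (suc (length xs)) xs ℕ.≤-refl)) ⟨
      horner w xs (suc (length xs)) + x * H
        ≈⟨ horner-∷ w x xs (length xs) ⟨
      horner w (x ∷ xs) (suc (length xs)) ∎
      where H = horner w xs (length xs)

    horner-sparse : ∀ w xs m → (∀ i → 0 < i → i ≤ m → e i xs ≈ 0#) → horner w xs m ≈ w ^ m
    horner-sparse w xs zero    _  = ≈-refl
    horner-sparse w xs (suc m) e≈0 = begin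
      horner w xs m * w + e (suc m) xs  ≈⟨ +-cong (*-congʳ (horner-sparse w xs m (λ i 0<i i≤m → e≈0 i 0<i (ℕ.m≤n⇒m≤1+n i≤m)))) (e≈0 (suc m) z<s ℕ.≤-refl) ⟩
      w ^ m * w + 0#                    ≈⟨ +-identityʳ _ ⟩
      w ^ m * w                         ≈⟨ *-comm _ _ ⟩
      w ^ suc m                         ∎

  -- This serves twice: for q equal entries it yields additivity of the q-th power, and for a
  -- translated clique it yields the equation of a line.
  ∏-sparse : ∀ w xs m → length xs ≡ 2 ℕ.+ m → (∀ i → 0 < i → i ≤ m → e i xs ≈ 0#) →
             ∏ (map (w +_) xs) ≈ w ^ (2 ℕ.+ m) + e (1 ℕ.+ m) xs * w + e (2 ℕ.+ m) xs
  ∏-sparse w xs m |xs| e≈0 = begin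
    ∏ (map (w +_) xs)                                          ≈⟨ ∏-horner w xs ⟩
    horner w xs (length xs)                                    ≡⟨ cong (horner w xs) |xs| ⟩
    (horner w xs m * w + e (suc m) xs) * w + e (2 ℕ.+ m) xs    ≈⟨ +-congʳ (*-congʳ (+-congʳ (*-congʳ (horner-sparse w xs m e≈0)))) ⟩
    (w ^ m * w + e (suc m) xs) * w + e (2 ℕ.+ m) xs            ≈⟨ solve 4 (λ W P A B → (P :* W :+ A) :* W :+ B := W :* (W :* P) :+ A :* W :+ B)
                                                                    (≈-refl) w (w ^ m) (e (suc m) xs) (e (2 ℕ.+ m) xs) ⟩
    w ^ (2 ℕ.+ m) + e (1 ℕ.+ m) xs * w + e (2 ℕ.+ m) xs        ∎

  e-replicate : ∀ i m a → e i (replicate m a) ≈ (m C i) ×′ (a ^ i)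
  e-replicate zero    m       a = ≈-sym (+-identityʳ _)
  e-replicate (suc i) zero    a = ≈-reflexive (cong (_×′ (a ^ suc i)) (≡.sym (k>n⇒nCk≡0 {0} {suc i} z<s)))
  e-replicate (suc i) (suc m) a = begin
    e (suc i) (replicate m a) + a * e i (replicate m a)    ≈⟨ +-cong (e-replicate (suc i) m a) (*-congˡ (e-replicate i m a)) ⟩
    (m C suc i) ×′ a ^ suc i + a * ((m C i) ×′ a ^ i)      ≈⟨ +-congˡ (×-comm-* (m C i) a (a ^ i)) ⟩
    (m C suc i) ×′ a ^ suc i + (m C i) ×′ a ^ suc i        ≈⟨ +-comm _ _ ⟩
    (m C i) ×′ a ^ suc i + (m C suc i) ×′ a ^ suc i        ≈⟨ ×-homo-+ (a ^ suc i) (m C i) (m C suc i) ⟨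
    (m C i ℕ.+ m C suc i) ×′ a ^ suc i                     ≡⟨ cong (_×′ (a ^ suc i)) (nCk+nC[k+1]≡[n+1]C[k+1] m i) ⟩
    (suc m C suc i) ×′ a ^ suc i                           ∎

  -- Polynomial functions, in Horner form

  -- The bound is strict: n distinct roots then suffice for vanishing, and the zero function is the
  -- base case. The coefficients are mere witnesses, so that functions of ξ such as `e n` of a list
  -- of sums can be treated directly.
  DegreeBelow : ℕ → (Carrier → Carrier) → Set (c ⊔ ℓ)
  DegreeBelow zero    f = ∀ x → f x ≈ 0#
  DegreeBelow (suc n) f = ∃[ a ] ∃[ f′ ] DegreeBelow n f′ × (∀ x → f x ≈ a + x * f′ x)

  DegreeBelow-resp : ∀ n {f f₁} → (∀ x → f₁ x ≈ f x) → DegreeBelow n f → DegreeBelow n f₁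
  DegreeBelow-resp zero    eq f≈0 x = ≈-trans (eq x) (f≈0 x)
  DegreeBelow-resp (suc n) eq (a , f′ , f′-deg , f≈) = a , f′ , f′-deg , λ x → ≈-trans (eq x) (f≈ x)

  0-DegreeBelow : ∀ n → DegreeBelow n (λ _ → 0#)
  0-DegreeBelow zero    x = ≈-refl
  0-DegreeBelow (suc n) = 0# , (λ _ → 0#) , 0-DegreeBelow n , λ x → ≈-sym (≈-trans (+-identityˡ _) (zeroʳ x))

  const-DegreeBelow : ∀ n a → DegreeBelow (suc n) (λ _ → a)
  const-DegreeBelow n a = a , (λ _ → 0#) , 0-DegreeBelow n , λ x → ≈-sym (≈-trans (+-congˡ (zeroʳ x)) (+-identityʳ a))

  +-DegreeBelow : ∀ n {f f₁} → DegreeBelow n f → DegreeBelow n f₁ → DegreeBelow n (λ x → f x + f₁ x)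
  +-DegreeBelow zero f≈0 f₁≈0 x = ≈-trans (+-cong (f≈0 x) (f₁≈0 x)) (+-identityˡ 0#)
  +-DegreeBelow (suc n) (a , f′ , f′-deg , f≈) (b , f₁′ , f₁′-deg , f₁≈) =
    a + b , (λ x → f′ x + f₁′ x) , +-DegreeBelow n f′-deg f₁′-deg , λ x → ≈-trans (+-cong (f≈ x) (f₁≈ x))
      (solve 5 (λ A B X F G → A :+ X :* F :+ (B :+ X :* G) := A :+ B :+ X :* (F :+ G)) (≈-refl) a b x (f′ x) (f₁′ x))

  *-DegreeBelow : ∀ n b {f} → DegreeBelow n f → DegreeBelow n (λ x → b * f x)
  *-DegreeBelow zero b f≈0 x = ≈-trans (*-congˡ (f≈0 x)) (zeroʳ b)
  *-DegreeBelow (suc n) b (a , f′ , f′-deg , f≈) = b * a , (λ x → b * f′ x) , *-DegreeBelow n b f′-deg ,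
    λ x → ≈-trans (*-congˡ (f≈ x)) (solve 4 (λ B A X F → B :* (A :+ X :* F) := B :* A :+ X :* (B :* F)) (≈-refl) b a x (f′ x))

  x*-DegreeBelow : ∀ n {f} → DegreeBelow n f → DegreeBelow (suc n) (λ x → x * f x)
  x*-DegreeBelow n {f} f-deg = 0# , f , f-deg , λ x → ≈-sym (+-identityˡ _)

  DegreeBelow-suc : ∀ n {f} → DegreeBelow n f → DegreeBelow (suc n) f
  DegreeBelow-suc zero    f≈0 = 0# , (λ _ → 0#) , (λ _ → ≈-refl) ,
    λ x → ≈-trans (f≈0 x) (≈-sym (≈-trans (+-identityˡ _) (zeroʳ x)))
  DegreeBelow-suc (suc n) (a , f′ , f′-deg , f≈) = a , f′ , DegreeBelow-suc n f′-deg , f≈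

  ^-DegreeBelow : ∀ n → DegreeBelow (suc n) (_^ n)
  ^-DegreeBelow zero    = const-DegreeBelow 0 1#
  ^-DegreeBelow (suc n) = x*-DegreeBelow (suc n) (^-DegreeBelow n)

  -- Every entry is linear in x, and a monomial of `e n` has n factors.
  e-DegreeBelow : ∀ {i} {I : Set i} (u v : I → Carrier) n is →
                  DegreeBelow (suc n) (λ x → e n (map (λ i → u i + x * v i) is))
  e-DegreeBelow u v zero    is = const-DegreeBelow 0 1#
  e-DegreeBelow u v (suc n) [] = 0-DegreeBelow (2 ℕ.+ n)
  e-DegreeBelow u v (suc n) (i ∷ is) =
    DegreeBelow-resp (2 ℕ.+ n)
      (λ x → solve 5 (λ E U X V G → E :+ (U :+ X :* V) :* G := E :+ U :* G :+ V :* (X :* G)) (≈-refl) (e (suc n) (rest x)) (u i) x (v i) (e n (rest x)))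
      (+-DegreeBelow (2 ℕ.+ n)
        (+-DegreeBelow (2 ℕ.+ n) (e-DegreeBelow u v (suc n) is) (DegreeBelow-suc (suc n) (*-DegreeBelow (suc n) (u i) (e-DegreeBelow u v n is))))
        (*-DegreeBelow (2 ℕ.+ n) (v i) (x*-DegreeBelow (suc n) (e-DegreeBelow u v n is))))
    where
    rest : Carrier → List Carrier
    rest x = map (λ i → u i + x * v i) is

  factor : ∀ n f r → DegreeBelow (suc n) f → ∃[ h ] DegreeBelow n h × (∀ x → f x ≈ f r + (x - r) * h x)
  factor zero f r (a , f′ , f′≈0 , f≈) = (λ _ → 0#) , (λ _ → ≈-refl) , λ x → begin
    f x                  ≈⟨ f≈a x ⟩
    a                    ≈⟨ f≈a r ⟨
    f r                  ≈⟨ +-identityʳ _ ⟨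
    f r + 0#             ≈⟨ +-congˡ (zeroʳ _) ⟨
    f r + (x - r) * 0#   ∎
    where
    f≈a : ∀ x → f x ≈ a
    f≈a x = ≈-trans (f≈ x) (≈-trans (+-congˡ (≈-trans (*-congˡ (f′≈0 x)) (zeroʳ x))) (+-identityʳ a))
  factor (suc n) f r (a , f′ , f′-deg , f≈) with factor n f′ r f′-deg
  ... | h , h-deg , f′≈ = (λ x → f′ r + x * h x) ,
    +-DegreeBelow (suc n) (const-DegreeBelow n (f′ r)) (x*-DegreeBelow n h-deg) , λ x → begin
      f x                                             ≈⟨ f≈ x ⟩
      a + x * f′ x                                    ≈⟨ +-congˡ (*-congˡ (f′≈ x)) ⟩
      a + x * (f′ r + (x - r) * h x)                  ≈⟨ +-identityʳ _ ⟨
      -- The semiring solver takes - r as an atom unrelated to r, so the cancelling term (r - r)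
      -- f′(r) is inserted by hand.
      a + x * (f′ r + (x - r) * h x) + 0#             ≈⟨ +-congˡ (≈-trans (*-congʳ (-‿inverseʳ r)) (zeroˡ _)) ⟨
      a + x * (f′ r + (x - r) * h x) + (r - r) * f′ r ≈⟨ solve 6 (λ A X F R R₋ H → A :+ X :* (F :+ (X :+ R₋) :* H) :+ (R :+ R₋) :* F := A :+ R :* F :+ (X :+ R₋) :* (F :+ X :* H)) (≈-refl) a x (f′ r) r (- r) (h x) ⟩
      a + r * f′ r + (x - r) * (f′ r + x * h x)       ≈⟨ +-congʳ (f≈ r) ⟨
      f r + (x - r) * (f′ r + x * h x)                ∎

  -- The q-th power map and blocks of q equal entries

  module Frobenius (m : ℕ) (qCi×x≈0 : ∀ i → 0 < i → i < 2 ℕ.+ m → ∀ x → ((2 ℕ.+ m) C i) ×′ x ≈ 0#) where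

    private
      q : ℕ
      q = 2 ℕ.+ m

    e-replicate-q : ∀ i a → 0 < i → i < q → e i (replicate q a) ≈ 0#
    e-replicate-q i a 0<i i<q = ≈-trans (e-replicate i q a) (qCi×x≈0 i 0<i i<q (a ^ i))

    e-q-replicate-q : ∀ a → e q (replicate q a) ≈ a ^ q
    e-q-replicate-q a = begin
      e q (replicate q a)   ≈⟨ e-replicate q q a ⟩
      (q C q) ×′ (a ^ q)    ≡⟨ cong (_×′ (a ^ q)) (nCn≡1 q) ⟩
      a ^ q + 0#            ≈⟨ +-identityʳ _ ⟩
      a ^ q                 ∎

    -- The power (x + y)^q is the product of x + y′ over q copies y′ of y, whose intermediate
    -- symmetric functions carry the vanishing binomial coefficients.
    frobenius-+ : ∀ x y → (x + y) ^ q ≈ x ^ q + y ^ q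
    frobenius-+ x y = begin
      (x + y) ^ q
        ≈⟨ ∏-replicate q ⟨
      ∏ (map (x +_) (replicate q y))
        ≈⟨ ∏-sparse x (replicate q y) m (List.length-replicate q) (λ i 0<i i≤m → e-replicate-q i y 0<i (s≤s (ℕ.m≤n⇒m≤1+n i≤m))) ⟩
      x ^ q + e (1 ℕ.+ m) (replicate q y) * x + e q (replicate q y)
        ≈⟨ +-cong (+-congˡ (≈-trans (*-congʳ (e-replicate-q (1 ℕ.+ m) y z<s ℕ.≤-refl)) (zeroˡ x))) (e-q-replicate-q y) ⟩
      x ^ q + 0# + y ^ q
        ≈⟨ +-congʳ (+-identityʳ _) ⟩
      x ^ q + y ^ q
        ∎
      where
      ∏-replicate : ∀ n → ∏ (map (x +_) (replicate n y)) ≈ (x + y) ^ n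
      ∏-replicate zero    = ≈-refl
      ∏-replicate (suc n) = *-congˡ (∏-replicate n)

    e-frobenius : ∀ n xs → e n (map (_^ q) xs) ≈ e n xs ^ q
    e-frobenius zero    xs       = ≈-sym (1^n≈1 q)
    e-frobenius (suc n) []       = ≈-sym (zeroˡ _)
    e-frobenius (suc n) (x ∷ xs) = begin
      e (suc n) (map (_^ q) xs) + x ^ q * e n (map (_^ q) xs)  ≈⟨ +-cong (e-frobenius (suc n) xs) (*-congˡ (e-frobenius n xs)) ⟩
      e (suc n) xs ^ q + x ^ q * e n xs ^ q                    ≈⟨ +-congˡ (^-distrib-* x (e n xs) q) ⟨
      e (suc n) xs ^ q + (x * e n xs) ^ q                      ≈⟨ frobenius-+ _ _ ⟨
      (e (suc n) xs + x * e n xs) ^ q                          ∎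

    -- In terms of generating functions, ∏ (1 + zT) is 1 modulo T^q, so appending zs leaves the
    -- coefficients below degree q alone.
    e-++-low : ∀ zs → (∀ i → 0 < i → i < q → e i zs ≈ 0#) → ∀ ys n → n < q → e n (ys ++ zs) ≈ e n ys
    e-++-low zs e≈0 []       zero    n<q = ≈-refl
    e-++-low zs e≈0 []       (suc n) n<q = e≈0 (suc n) z<s n<q
    e-++-low zs e≈0 (y ∷ ys) zero    n<q = ≈-refl
    e-++-low zs e≈0 (y ∷ ys) (suc n) n<q =
      +-cong (e-++-low zs e≈0 ys (suc n) n<q) (*-congˡ (e-++-low zs e≈0 ys n (ℕ.<-trans (ℕ.n<1+n n) n<q)))

    -- Here ∏ (1 + zT) is exactly 1 + `e q zs` T^q, so only two terms contribute to each
    -- coefficient.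
    e-++-high : ∀ zs → length zs ≡ q → (∀ i → 0 < i → i < q → e i zs ≈ 0#) → ∀ ys n →
                e (n ℕ.+ q) (ys ++ zs) ≈ e (n ℕ.+ q) ys + e q zs * e n ys
    e-++-high zs |zs|≡q e≈0 [] zero = ≈-sym (≈-trans (+-identityˡ _) (*-identityʳ _))
    e-++-high zs |zs|≡q e≈0 [] (suc n) = begin
      e (suc n ℕ.+ q) zs  ≈⟨ e-overflow (suc n ℕ.+ q) zs (s≤s (ℕ.≤-trans (ℕ.≤-reflexive |zs|≡q) (ℕ.m≤n+m q n))) ⟩
      0#                  ≈⟨ zeroʳ _ ⟨
      e q zs * 0#         ≈⟨ +-identityˡ _ ⟨
      0# + e q zs * 0#    ∎
    e-++-high zs |zs|≡q e≈0 (y ∷ ys) zero = begin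
      e q (ys ++ zs) + y * e (1 ℕ.+ m) (ys ++ zs)
        ≈⟨ +-cong (e-++-high zs |zs|≡q e≈0 ys 0) (*-congˡ (e-++-low zs e≈0 ys (1 ℕ.+ m) ℕ.≤-refl)) ⟩
      e q ys + e q zs * 1# + y * e (1 ℕ.+ m) ys
        ≈⟨ solve 3 (λ A B C → A :+ B :+ C := A :+ C :+ B) ≈-refl (e q ys) (e q zs * 1#) (y * e (1 ℕ.+ m) ys) ⟩
      e q ys + y * e (1 ℕ.+ m) ys + e q zs * 1#
        ∎
    e-++-high zs |zs|≡q e≈0 (y ∷ ys) (suc n) = begin
      e (suc n ℕ.+ q) (ys ++ zs) + y * e (n ℕ.+ q) (ys ++ zs)
        ≈⟨ +-cong (e-++-high zs |zs|≡q e≈0 ys (suc n)) (*-congˡ (e-++-high zs |zs|≡q e≈0 ys n)) ⟩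
      e (suc n ℕ.+ q) ys + e q zs * e (suc n) ys + y * (e (n ℕ.+ q) ys + e q zs * e n ys)
        ≈⟨ solve 6 (λ A Z B Y C D → A :+ Z :* B :+ Y :* (C :+ Z :* D) := A :+ Y :* C :+ Z :* (B :+ Y :* D))
             ≈-refl (e (suc n ℕ.+ q) ys) (e q zs) (e (suc n) ys) y (e (n ℕ.+ q) ys) (e n ys) ⟩
      e (suc n ℕ.+ q) (y ∷ ys) + e q zs * e (suc n) (y ∷ ys)
        ∎

    -- The block of an index i has generating function (1 + bT)^q = 1 + b^q T^q with b = `b i`. The
    -- product over the blocks is thus a polynomial in T^q, whose coefficients are the symmetric
    -- functions of the q-th powers.
    e-blocks : ∀ {i} {I J : Set i} (f : I × J → Carrier) (b : I → Carrier) → (∀ i j → f (i , j) ≈ b i) →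
               ∀ js → length js ≡ q → ∀ is n → e (n ℕ.* q) (map f (cartesianProduct is js)) ≈ e n (map b is) ^ q
    e-blocks f b f≈b js |js|≡q is n = ≈-trans (blocks is n) (≈-trans (≈-reflexive (cong (e n) (List.map-∘ is))) (e-frobenius n (map b is)))
      where
      constant : ∀ i js → map f (map (i ,_) js) ≋ replicate (length js) (b i)
      constant i []       = []
      constant i (j ∷ js) = f≈b i j ∷ constant i js

      blocks : ∀ is n → e (n ℕ.* q) (map f (cartesianProduct is js)) ≈ e n (map (λ i → b i ^ q) is)
      blocks is       zero    = ≈-refl
      blocks []       (suc n) = ≈-refl
      blocks (i ∷ is) (suc n) = begin
        e (q ℕ.+ n ℕ.* q) (map f (map (i ,_) js ++ cartesianProduct is js))
          ≡⟨ cong₂ e (ℕ.+-comm q (n ℕ.* q)) (List.map-++ f (map (i ,_) js) (cartesianProduct is js)) ⟩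
        -- The block is moved to the end, because `e-++-high` treats it as the appended list.
        e (n ℕ.* q ℕ.+ q) (map f (map (i ,_) js) ++ rest)
          ≈⟨ e-resp-↭ (n ℕ.* q ℕ.+ q) (Permutationₚ.++-comm (map f (map (i ,_) js)) rest) ⟩
        e (n ℕ.* q ℕ.+ q) (rest ++ map f (map (i ,_) js))
          ≈⟨ e-++-high (map f (map (i ,_) js)) |block|≡q (λ k 0<k k<q → ≈-trans (e-block k) (e-replicate-q k (b i) 0<k k<q)) rest (n ℕ.* q) ⟩
        e (n ℕ.* q ℕ.+ q) rest + e q (map f (map (i ,_) js)) * e (n ℕ.* q) rest
          ≡⟨ cong (λ k → e k rest + e q (map f (map (i ,_) js)) * e (n ℕ.* q) rest) (ℕ.+-comm (n ℕ.* q) q) ⟩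
        e (suc n ℕ.* q) rest + e q (map f (map (i ,_) js)) * e (n ℕ.* q) rest
          ≈⟨ +-cong (blocks is (suc n)) (*-cong (≈-trans (e-block q) (e-q-replicate-q (b i))) (blocks is n)) ⟩
        e (suc n) (map (λ i → b i ^ q) (i ∷ is))
          ∎
        where
        rest : List Carrier
        rest = map f (cartesianProduct is js)
        |block|≡q : length (map f (map (i ,_) js)) ≡ q
        |block|≡q = ≡.trans (List.length-map f (map (i ,_) js)) (≡.trans (List.length-map (i ,_) js) |js|≡q)
        e-block : ∀ k → e k (map f (map (i ,_) js)) ≈ e k (replicate q (b i))
        e-block k = ≈-trans (e-cong k (constant i js)) (≈-reflexive (cong (λ l → e k (replicate l (b i))) |js|≡q))

  -- Roots of polynomial functions

  module NoZeroDivisors (x*y≈0⇒y≈0 : ∀ {x y} → x ≉ 0# → x * y ≈ 0# → y ≈ 0#) where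

    DegreeBelow-roots : ∀ n f → DegreeBelow n f → (r : Fin n → Carrier) →
                        (∀ {i j} → r i ≈ r j → i ≡ j) → (∀ i → f (r i) ≈ 0#) → ∀ x → f x ≈ 0#
    DegreeBelow-roots zero    f f≈0 r r-inj fr≈0 = f≈0
    DegreeBelow-roots (suc n) f f-deg r r-inj fr≈0 x with factor n f (r zero) f-deg
    ... | h , h-deg , f≈ = begin
      f x                                   ≈⟨ f≈ x ⟩
      f (r zero) + (x - r zero) * h x       ≈⟨ +-cong (fr≈0 zero) (*-congˡ (h≈0 x)) ⟩
      0# + (x - r zero) * 0#                ≈⟨ +-identityˡ _ ⟩
      (x - r zero) * 0#                     ≈⟨ zeroʳ _ ⟩
      0#                                    ∎
      where
      h≈0 : ∀ x → h x ≈ 0#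
      h≈0 = DegreeBelow-roots n h h-deg (r ∘ suc) (Fin.suc-injective ∘ r-inj) λ i →
        x*y≈0⇒y≈0 (λ r-r≈0 → contradiction (r-inj (x∙y⁻¹≈ε⇒x≈y _ _ r-r≈0)) λ ())
          (begin
            (r (suc i) - r zero) * h (r (suc i))                  ≈⟨ +-identityˡ _ ⟨
            0# + (r (suc i) - r zero) * h (r (suc i))             ≈⟨ +-congʳ (fr≈0 zero) ⟨
            f (r zero) + (r (suc i) - r zero) * h (r (suc i))     ≈⟨ f≈ (r (suc i)) ⟨
            f (r (suc i))                                         ≈⟨ fr≈0 (suc i) ⟩
            0#                                                    ∎)

length-cartesianProduct : ∀ {a b} {A : Set a} {B : Set b} (xs : List A) (ys : List B) →
                          length (cartesianProduct xs ys) ≡ length xs ℕ.* length ys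
length-cartesianProduct []       ys = ≡.refl
length-cartesianProduct (x ∷ xs) ys = ≡.trans (List.length-++ (map (x ,_) ys))
  (cong₂ ℕ._+_ (List.length-map (x ,_) ys) (length-cartesianProduct xs ys))

-- Repetition-free lists and finite setoids

module UniqueLists {a ℓ} (A : Setoid a ℓ) where

  open Setoid A renaming (refl to ≈-refl; sym to ≈-sym; trans to ≈-trans)
  open Membership A using (_∈_)
  open UniqueSetoid A using (Unique)
  open Permutation A using (_↭_; ↭-trans; ↭-sym; ↭-prep; ↭-reflexive-≋)
  open PermutationProperties A using (∈-resp-↭; shift; xs↭ys⇒|xs|≡|ys|)
  open import Data.List.Relation.Binary.Equality.Setoid A using (≋-refl)

  ∈⇒↭∷ : ∀ {x ys} → x ∈ ys → ∃[ zs ] ys ↭ x ∷ zs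
  ∈⇒↭∷ x∈ys with Membershipₚ.∈-∃++ A x∈ys
  ... | as , bs , w , x≈w , ys≋ = as ++ bs , ↭-trans (↭-reflexive-≋ ys≋) (shift (≈-sym x≈w) as bs)

  unique∧⊆⇒↭ : ∀ {xs ys} → Unique xs → (∀ {x} → x ∈ xs → x ∈ ys) → length ys ≤ length xs → xs ↭ ys
  unique∧⊆⇒↭ {[]}     {[]} _ _ _ = ↭-reflexive-≋ ≋-refl
  unique∧⊆⇒↭ {x ∷ xs} {ys} (x∉xs ∷ xs!) xs⊆ys |ys|≤ with ∈⇒↭∷ (xs⊆ys (here ≈-refl))
  ... | zs , ys↭ = ↭-trans (↭-prep x (unique∧⊆⇒↭ xs! xs⊆zs |zs|≤)) (↭-sym ys↭)
    where
    |zs|≤ : length zs ≤ length xs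
    |zs|≤ = s≤s⁻¹ (ℕ.≤-trans (ℕ.≤-reflexive (≡.sym (xs↭ys⇒|xs|≡|ys| ys↭))) |ys|≤)
    xs⊆zs : ∀ {z} → z ∈ xs → z ∈ zs
    xs⊆zs z∈xs with ∈-resp-↭ ys↭ (xs⊆ys (there z∈xs))
    ... | there z∈zs = z∈zs
    ... | here z≈x = contradiction (Membershipₚ.∈-resp-≈ A z≈x z∈xs) (Uniqueₚ.Unique[x∷xs]⇒x∉xs A (x∉xs ∷ xs!))

  lookup-injective : ∀ {xs} → Unique xs → ∀ {i j} → lookup xs i ≈ lookup xs j → i ≡ j
  lookup-injective (_ ∷ _)      {zero}  {zero}  _  = ≡.refl
  lookup-injective (x∉xs ∷ xs!) {zero}  {suc j} eq = contradiction eq (All.lookup x∉xs (∈-lookup j))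
  lookup-injective (x∉xs ∷ xs!) {suc i} {zero}  eq = contradiction (≈-sym eq) (All.lookup x∉xs (∈-lookup i))
  lookup-injective (x∉xs ∷ xs!) {suc i} {suc j} eq = cong suc (lookup-injective xs! eq)

  module Finite {n} (size : HasSize A n) where

    open Inverse size public using (to; from; to-cong) renaming (strictlyInverseʳ to from-to; strictlyInverseˡ to to-from)

    to-injective : ∀ {x y} → to x ≡ to y → x ≈ y
    to-injective {x} {y} eq = ≈-trans (≈-sym (from-to x)) (≈-trans (Setoid.reflexive A (cong from eq)) (from-to y))

    from-injective : ∀ {i j} → from i ≈ from j → i ≡ j
    from-injective {i} {j} eq = ≡.trans (≡.sym (to-from i)) (≡.trans (to-cong eq) (to-from j))

    infix 4 _≟_
    _≟_ : ∀ x y → Dec (x ≈ y)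
    x ≟ y = map′ to-injective to-cong (to x Fin.≟ to y)

    elements : List Carrier
    elements = tabulate from

    |elements| : length elements ≡ n
    |elements| = List.length-tabulate from

    elements! : Unique elements
    elements! = Uniqueₚ.tabulate⁺ A from-injective

    ∈-elements : ∀ x → x ∈ elements
    ∈-elements x = Membershipₚ.∈-resp-≈ A (from-to x) (Membershipₚ.∈-tabulate⁺ A (to x))

    ↭-elements : ∀ {xs} → Unique xs → length xs ≡ n → xs ↭ elements
    ↭-elements xs! |xs| = unique∧⊆⇒↭ xs! (λ _ → ∈-elements _) (ℕ.≤-reflexive (≡.trans |elements| (≡.sym |xs|)))

    collision : ∀ {m} → n < m → (f : Fin m → Carrier) → ∃[ i ] ∃[ j ] toℕ i < toℕ j × f i ≈ f j
    collision n<m f with Fin.pigeonhole n<m (to ∘ f)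
    ... | i , j , i<j , eq = i , j , i<j , to-injective eq

    -- Since only the representatives `from i` are compared, `f` need not respect `_≈_`. This admits
    -- codes read off from chosen logarithms, which may depend on the representative.
    coincidence : ∀ {m} → m < n → (f : Carrier → Fin m) → ¬ (∀ x y → f x ≡ f y → x ≈ y)
    coincidence m<n f f-inj with Fin.pigeonhole m<n (f ∘ from)
    ... | i , j , i<j , eq = ℕ.<⇒≢ i<j (cong toℕ (from-injective (f-inj _ _ eq)))

-- Arithmetic in a finite field with N nonzero elements

module FiniteField {c ℓ} (R : CommutativeRing c ℓ) (N : ℕ)
  (size : HasSize (CommutativeRing.setoid R) (suc N))
  (1≉0 : CommutativeRing._≉_ R (CommutativeRing.1# R) (CommutativeRing.0# R))
  (inverse : ∀ x → CommutativeRing._≉_ R x (CommutativeRing.0# R) →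
             ∃[ y ] CommutativeRing._≈_ R (CommutativeRing._*_ R x y) (CommutativeRing.1# R))
  where

  open CommutativeRing R hiding (zero)
    renaming (refl to ≈-refl; sym to ≈-sym; trans to ≈-trans)
  open Exp semiring using (_^_; ^-congˡ; ^-homo-*; ^-assocʳ)
  open Mult semiring using (×-congʳ; ×-congˡ; ×-assoc-*; ×1-homo-*) renaming (_×_ to _×′_)
  open RingProperties ring using (-‿involutive; x∙y⁻¹≈ε⇒x≈y; -‿+-comm; +-cancelʳ; +-cancelˡ; -1*x≈-x)
  open SemiringSolver commutativeSemiring using (solve; _:+_; _:*_; _:=_)
  open Membership setoid using (_∈_)
  open UniqueSetoid setoid using (Unique)
  open PermutationProperties setoid using (xs↭ys⇒|xs|≡|ys|; Unique-resp-↭)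
  open SetoidReasoning setoid
  open RingTheory R
  open UniqueLists setoid public
  open Finite size public

  x*y≈0⇒y≈0 : ∀ {x y} → x ≉ 0# → x * y ≈ 0# → y ≈ 0#
  x*y≈0⇒y≈0 {x} {y} x≉0 xy≈0 with inverse x x≉0
  ... | z , xz≈1 = begin
    y            ≈⟨ *-identityˡ y ⟨
    1# * y       ≈⟨ *-congʳ xz≈1 ⟨
    x * z * y    ≈⟨ solve 3 (λ X Z Y → X :* Z :* Y := Z :* (X :* Y)) ≈-refl x z y ⟩
    z * (x * y)  ≈⟨ *-congˡ xy≈0 ⟩
    z * 0#       ≈⟨ zeroʳ z ⟩
    0#           ∎

  open NoZeroDivisors x*y≈0⇒y≈0 public

  *-cancelˡ : ∀ {x y z} → x ≉ 0# → x * y ≈ x * z → y ≈ z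
  *-cancelˡ {x} {y} {z} x≉0 xy≈xz = x∙y⁻¹≈ε⇒x≈y y z (x*y≈0⇒y≈0 x≉0 (begin
    x * (y - z)        ≈⟨ distribˡ x y (- z) ⟩
    x * y + x * - z    ≈⟨ +-congʳ xy≈xz ⟩
    x * z + x * - z    ≈⟨ distribˡ x z (- z) ⟨
    x * (z - z)        ≈⟨ *-congˡ (-‿inverseʳ z) ⟩
    x * 0#             ≈⟨ zeroʳ x ⟩
    0#                 ∎))

  x*y≉0 : ∀ {x y} → x ≉ 0# → y ≉ 0# → x * y ≉ 0#
  x*y≉0 x≉0 y≉0 xy≈0 = y≉0 (x*y≈0⇒y≈0 x≉0 xy≈0)

  ^≉0 : ∀ {x} n → x ≉ 0# → x ^ n ≉ 0#
  ^≉0 zero    x≉0 = 1≉0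
  ^≉0 (suc n) x≉0 = x*y≉0 x≉0 (^≉0 n x≉0)

  ^≈0⇒≈0 : ∀ n {x} → x ^ n ≈ 0# → x ≈ 0#
  ^≈0⇒≈0 n {x} xⁿ≈0 with x ≟ 0#
  ... | yes x≈0 = x≈0
  ... | no x≉0 = contradiction xⁿ≈0 (^≉0 n x≉0)

  x*y≈1⇒y≉0 : ∀ {x y} → x * y ≈ 1# → y ≉ 0#
  x*y≈1⇒y≉0 {x} {y} xy≈1 y≈0 = 1≉0 (begin
    1#      ≈⟨ xy≈1 ⟨
    x * y   ≈⟨ *-congˡ y≈0 ⟩
    x * 0#  ≈⟨ zeroʳ x ⟩
    0#      ∎)

  abstract

    -- With the convention 1/0 = 0 the map is injective on the whole field, and it sends a list
    -- containing 0 to 0 together with the reciprocals of the other entries.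
    inv : Carrier → Carrier
    inv x with x ≟ 0#
    ... | yes _  = 0#
    ... | no x≉0 = proj₁ (inverse x x≉0)

    inv-0 : ∀ {x} → x ≈ 0# → inv x ≈ 0#
    inv-0 {x} x≈0 with x ≟ 0#
    ... | yes _  = ≈-refl
    ... | no x≉0 = contradiction x≈0 x≉0

    *-inv : ∀ {x} → x ≉ 0# → x * inv x ≈ 1#
    *-inv {x} x≉0 with x ≟ 0#
    ... | yes x≈0 = contradiction x≈0 x≉0
    ... | no x≉0′ = proj₂ (inverse x x≉0′)

    inv-cong : ∀ {x y} → x ≈ y → inv x ≈ inv y
    inv-cong {x} {y} x≈y with x ≟ 0# | y ≟ 0#
    ... | yes _   | yes _   = ≈-refl
    ... | yes x≈0 | no y≉0  = contradiction (≈-trans (≈-sym x≈y) x≈0) y≉0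
    ... | no x≉0  | yes y≈0 = contradiction (≈-trans x≈y y≈0) x≉0
    ... | no x≉0  | no y≉0  = *-cancelˡ x≉0 (≈-trans (proj₂ (inverse x x≉0))
            (≈-trans (≈-sym (proj₂ (inverse y y≉0))) (*-congʳ (≈-sym x≈y))))

    inv-injective : ∀ {x y} → inv x ≈ inv y → x ≈ y
    inv-injective {x} {y} x⁻¹≈y⁻¹ with x ≟ 0# | y ≟ 0#
    ... | yes x≈0 | yes y≈0 = ≈-trans x≈0 (≈-sym y≈0)
    ... | yes x≈0 | no y≉0  = contradiction (≈-sym x⁻¹≈y⁻¹) (x*y≈1⇒y≉0 (proj₂ (inverse y y≉0)))
    ... | no x≉0  | yes y≈0 = contradiction x⁻¹≈y⁻¹ (x*y≈1⇒y≉0 (proj₂ (inverse x x≉0)))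
    ... | no x≉0  | no y≉0  = *-cancelˡ (x*y≈1⇒y≉0 (proj₂ (inverse x x≉0))) (begin
      proj₁ (inverse x x≉0) * x  ≈⟨ *-comm _ _ ⟩
      x * proj₁ (inverse x x≉0)  ≈⟨ proj₂ (inverse x x≉0) ⟩
      1#                         ≈⟨ proj₂ (inverse y y≉0) ⟨
      y * proj₁ (inverse y y≉0)  ≈⟨ *-congˡ x⁻¹≈y⁻¹ ⟨
      y * proj₁ (inverse x x≉0)  ≈⟨ *-comm _ _ ⟩
      proj₁ (inverse x x≉0) * y  ∎)

  inverses : ∀ {ys} → All (0# ≉_) ys → Pointwise (λ y z → y * z ≈ 1#) ys (map inv ys)
  inverses []           = []
  inverses (0≉y ∷ 0∉ys) = *-inv (0≉y ∘ ≈-sym) ∷ inverses 0∉ys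

  [x-z]-[y-z]≈x-y : ∀ x y z → x - z - (y - z) ≈ x - y
  [x-z]-[y-z]≈x-y x y z = begin
    x - z - (y - z)        ≈⟨ +-congˡ (-‿+-comm y (- z)) ⟨
    x - z + (- y - - z)    ≈⟨ +-congˡ (+-congˡ (-‿involutive z)) ⟩
    x - z + (- y + z)      ≈⟨ solve 4 (λ X Z₋ Y₋ Z → X :+ Z₋ :+ (Y₋ :+ Z) := X :+ Y₋ :+ (Z :+ Z₋)) ≈-refl x (- z) (- y) z ⟩
    x - y + (z - z)        ≈⟨ +-congˡ (-‿inverseʳ z) ⟩
    x - y + 0#             ≈⟨ +-identityʳ _ ⟩
    x - y                  ∎

  x*y≈y⇒y≈0 : ∀ {x y} → x ≉ 1# → x * y ≈ y → y ≈ 0#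
  x*y≈y⇒y≈0 {x} {y} x≉1 xy≈y with y ≟ 0#
  ... | yes y≈0 = y≈0
  ... | no y≉0 = contradiction (*-cancelˡ y≉0 (≈-trans (*-comm y x) (≈-trans xy≈y (≈-sym (*-identityʳ y))))) x≉1

  -- Translation by 1 permutes the field, so it does not change `e 1 elements`, the sum of all
  -- elements.
  [1+N]×1≈0 : suc N ×′ 1# ≈ 0#
  [1+N]×1≈0 = +-cancelʳ (e 1 elements) (suc N ×′ 1#) 0# (begin
    suc N ×′ 1# + e 1 elements            ≡⟨ cong (λ n → n ×′ 1# + e 1 elements) |elements| ⟨
    length elements ×′ 1# + e 1 elements  ≈⟨ e₁-translate 1# elements ⟨
    e 1 (map (1# +_) elements)            ≈⟨ e-resp-↭ 1 (↭-elements (Uniqueₚ.map⁺ setoid setoid (+-cancelˡ 1# _ _) elements!) (≡.trans (List.length-map (1# +_) elements) |elements|)) ⟩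
    e 1 elements                          ≈⟨ +-identityˡ _ ⟨
    0# + e 1 elements                     ∎)

  -- The n-th power of p · 1 is p^n · 1 = 0, and a field has no nonzero nilpotents.
  characteristic : ∀ p n → suc N ≡ p ℕ.^ n → p ×′ 1# ≈ 0#
  characteristic p n 1+N≡pⁿ = ^≈0⇒≈0 n (≈-trans (power n) (≈-trans (×-congˡ (≡.sym 1+N≡pⁿ)) [1+N]×1≈0))
    where
    power : ∀ n → (p ×′ 1#) ^ n ≈ (p ℕ.^ n) ×′ 1#
    power zero    = ≈-sym (+-identityʳ 1#)
    power (suc n) = ≈-trans (*-congˡ (power n)) (≈-sym (×1-homo-* p (p ℕ.^ n)))

  ∣⇒×≈0 : ∀ {p n} → p ×′ 1# ≈ 0# → p ∣ n → ∀ x → n ×′ x ≈ 0#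
  ∣⇒×≈0 {p} {n} p×1≈0 (divides k n≡k*p) x = begin
    n ×′ x                 ≈⟨ ×-congʳ n (*-identityˡ x) ⟨
    n ×′ (1# * x)          ≈⟨ ×-assoc-* n 1# x ⟨
    (n ×′ 1#) * x          ≡⟨ cong (λ n → (n ×′ 1#) * x) n≡k*p ⟩
    ((k ℕ.* p) ×′ 1#) * x  ≈⟨ *-congʳ (×1-homo-* k p) ⟩
    (k ×′ 1#) * (p ×′ 1#) * x  ≈⟨ *-congʳ (*-congˡ p×1≈0) ⟩
    (k ×′ 1#) * 0# * x     ≈⟨ *-congʳ (zeroʳ _) ⟩
    0# * x                 ≈⟨ zeroˡ x ⟩
    0#                     ∎

  -- Multiplication by x permutes xs, so it multiplies the product of the nonzero elements of xs by 1.
  lagrange : ∀ {n xs x} → Unique xs → length xs ≡ suc n → 0# ∈ xs → x ≉ 0# →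
             (∀ {y} → y ∈ xs → x * y ∈ xs) → x ^ n ≈ 1#
  lagrange {n} {xs} {x} xs! |xs| 0∈xs x≉0 x*xs⊆xs with ∈⇒↭∷ 0∈xs
  ... | ys , xs↭0∷ys with Unique-resp-↭ xs↭0∷ys xs! | ℕ.suc-injective (≡.trans (≡.sym (xs↭ys⇒|xs|≡|ys| xs↭0∷ys)) |xs|)
  ...   | 0∉ys ∷ _ | ≡.refl = *-cancelˡ (eₙ≉0 0∉ys) (begin
    e n xs * x ^ n         ≈⟨ *-comm _ _ ⟩
    x ^ n * e n xs         ≈⟨ e-scale n x xs ⟨
    e n (map (x *_) xs)    ≈⟨ e-resp-↭ n (unique∧⊆⇒↭ (Uniqueₚ.map⁺ setoid setoid (*-cancelˡ x≉0) xs!)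
                                map⊆ (ℕ.≤-reflexive (≡.sym (List.length-map (x *_) xs)))) ⟩
    e n xs                 ≈⟨ *-identityʳ _ ⟨
    e n xs * 1#            ∎)
    where
    map⊆ : ∀ {z} → z ∈ map (x *_) xs → z ∈ xs
    map⊆ z∈ with Membershipₚ.∈-map⁻ setoid setoid z∈
    ... | y , y∈xs , z≈xy = Membershipₚ.∈-resp-≈ setoid (≈-sym z≈xy) (x*xs⊆xs y∈xs)
    eₙ≉0 : All (0# ≉_) ys → e n xs ≉ 0#
    eₙ≉0 0∉ys eₙ≈0 = 1≉0 (begin
      1#                           ≈⟨ e-reciprocal (inverses 0∉ys) n 0 (ℕ.+-identityʳ n) ⟨
      e n ys * e n (map inv ys)    ≈⟨ *-congʳ (≈-trans (≈-sym (e-0∷ n ys ≈-refl)) (≈-sym (e-resp-↭ n xs↭0∷ys))) ⟩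
      e n xs * e n (map inv ys)    ≈⟨ *-congʳ eₙ≈0 ⟩
      0# * e n (map inv ys)        ≈⟨ zeroˡ _ ⟩
      0#                           ∎)

  -- The order of the generator

  module Generator (g : Carrier) (g≉0 : g ≉ 0#) (log : ∀ x → x ≉ 0# → ∃[ n ] x ≈ g ^ n) where

    ^-cancel : ∀ {i j} → i ≤ j → g ^ i ≈ g ^ j → g ^ (j ℕ.∸ i) ≈ 1#
    ^-cancel {i} {j} i≤j gⁱ≈gʲ = *-cancelˡ (^≉0 i g≉0) (begin
      g ^ i * g ^ (j ℕ.∸ i)    ≈⟨ ^-homo-* g i (j ℕ.∸ i) ⟨
      g ^ (i ℕ.+ (j ℕ.∸ i))    ≡⟨ cong (g ^_) (ℕ.m+[n∸m]≡n i≤j) ⟩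
      g ^ j                    ≈⟨ gⁱ≈gʲ ⟨
      g ^ i                    ≈⟨ *-identityʳ _ ⟨
      g ^ i * 1#               ∎)

    ^-mod : ∀ n → g ^ suc n ≈ 1# → ∀ t → g ^ t ≈ g ^ (t % suc n)
    ^-mod n gⁿ≈1 t = begin
      g ^ t                                                ≡⟨ cong (g ^_) (m≡m%n+[m/n]*n t (suc n)) ⟩
      g ^ (t % suc n ℕ.+ t / suc n ℕ.* suc n)              ≈⟨ ^-homo-* g (t % suc n) _ ⟩
      g ^ (t % suc n) * g ^ (t / suc n ℕ.* suc n)          ≡⟨ cong (λ k → g ^ (t % suc n) * g ^ k) (ℕ.*-comm (t / suc n) (suc n)) ⟩
      g ^ (t % suc n) * g ^ (suc n ℕ.* (t / suc n))        ≈⟨ *-congˡ (^-assocʳ g (suc n) (t / suc n)) ⟨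
      g ^ (t % suc n) * (g ^ suc n) ^ (t / suc n)          ≈⟨ *-congˡ (≈-trans (^-congˡ (t / suc n) gⁿ≈1) (1^n≈1 (t / suc n))) ⟩
      g ^ (t % suc n) * 1#                                 ≈⟨ *-identityʳ _ ⟩
      g ^ (t % suc n)                                      ∎

    -- If g^n = 1, a nonzero element is determined by its logarithm modulo n. Together with 0 this
    -- leaves at most 1 + n elements in a field of 1 + N.
    N≤order : ∀ n → 0 < n → g ^ n ≈ 1# → N ≤ n
    N≤order (suc n) _ gⁿ≈1 with N ℕ.≤? suc n
    ... | yes N≤n = N≤n
    ... | no N≰n = contradiction code-injective (coincidence (s≤s (ℕ.≰⇒> N≰n)) code)
      where
      code : Carrier → Fin (2 ℕ.+ n)
      code x with x ≟ 0#
      ... | yes _  = zero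
      ... | no x≉0 = suc (fromℕ< (m%n<n (proj₁ (log x x≉0)) (suc n)))
      code-injective : ∀ x y → code x ≡ code y → x ≈ y
      code-injective x y eq with x ≟ 0# | y ≟ 0#
      ... | yes x≈0 | yes y≈0 = ≈-trans x≈0 (≈-sym y≈0)
      ... | no x≉0 | no y≉0 with log x x≉0 | log y y≉0
      ...   | s , x≈gˢ | t , y≈gᵗ = begin
        x                ≈⟨ x≈gˢ ⟩
        g ^ s            ≈⟨ ^-mod n gⁿ≈1 s ⟩
        g ^ (s % suc n)  ≡⟨ cong (g ^_) (Fin.fromℕ<-injective _ _ _ _ (Fin.suc-injective eq)) ⟩
        g ^ (t % suc n)  ≈⟨ ^-mod n gⁿ≈1 t ⟨
        g ^ t            ≈⟨ y≈gᵗ ⟨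
        y                ∎

    ^-injective : ∀ {i j} → i < N → j < N → g ^ i ≈ g ^ j → i ≡ j
    ^-injective {i} {j} i<N j<N gⁱ≈gʲ with ℕ.<-cmp i j
    ... | tri≈ _ i≡j _ = i≡j
    ... | tri< i<j _ _ = contradiction (N≤order (j ℕ.∸ i) (ℕ.m<n⇒0<n∸m i<j) (^-cancel (ℕ.<⇒≤ i<j) gⁱ≈gʲ))
                           (ℕ.<⇒≱ (ℕ.≤-<-trans (ℕ.m∸n≤m j i) j<N))
    ... | tri> _ _ j<i = contradiction (N≤order (i ℕ.∸ j) (ℕ.m<n⇒0<n∸m j<i) (^-cancel (ℕ.<⇒≤ j<i) (≈-sym gⁱ≈gʲ)))
                           (ℕ.<⇒≱ (ℕ.≤-<-trans (ℕ.m∸n≤m i j) i<N))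

    -- Among 0, g^0, ..., g^N two elements coincide, and 0 is not one of them. The difference of the
    -- exponents is a period that is at most N, and at least N by `N≤order`.
    g^N≈1 : g ^ N ≈ 1#
    g^N≈1 with collision {2 ℕ.+ N} ℕ.≤-refl f
      where
      f : Fin (2 ℕ.+ N) → Carrier
      f zero    = 0#
      f (suc i) = g ^ toℕ i
    ... | zero  , suc j , _ , 0≈gʲ = contradiction (≈-sym 0≈gʲ) (^≉0 (toℕ j) g≉0)
    ... | suc i , suc j , s≤s i<j , gⁱ≈gʲ = subst (λ n → g ^ n ≈ 1#) (ℕ.≤-antisym
            (ℕ.≤-trans (ℕ.m∸n≤m (toℕ j) (toℕ i)) (s≤s⁻¹ (Fin.toℕ<n j)))
            (N≤order (toℕ j ℕ.∸ toℕ i) (ℕ.m<n⇒0<n∸m i<j) gʲ⁻ⁱ≈1)) gʲ⁻ⁱ≈1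
      where
      gʲ⁻ⁱ≈1 : g ^ (toℕ j ℕ.∸ toℕ i) ≈ 1#
      gʲ⁻ⁱ≈1 = ^-cancel (ℕ.<⇒≤ i<j) gⁱ≈gʲ

    g^n≈1⇒N∣n : .{{_ : NonZero N}} → ∀ n → g ^ n ≈ 1# → N ∣ n
    g^n≈1⇒N∣n n gⁿ≈1 with n % N in n%N≡
    ... | zero  = m%n≡0⇒n∣m n N n%N≡
    ... | suc r = contradiction (N≤order (n % N) (subst (0 <_) (≡.sym n%N≡) z<s) gⁿ%ᴺ≈1) (ℕ.<⇒≱ (m%n<n n N))
      where
      gⁿ%ᴺ≈1 : g ^ (n % N) ≈ 1#
      gⁿ%ᴺ≈1 = *-cancelˡ (^≉0 (n / N ℕ.* N) g≉0) (begin
        g ^ (n / N ℕ.* N) * g ^ (n % N)    ≈⟨ ^-homo-* g (n / N ℕ.* N) (n % N) ⟨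
        g ^ (n / N ℕ.* N ℕ.+ n % N)        ≡⟨ cong (g ^_) (≡.trans (ℕ.+-comm (n / N ℕ.* N) (n % N)) (≡.sym (m≡m%n+[m/n]*n n N))) ⟩
        g ^ n                              ≈⟨ gⁿ≈1 ⟩
        1#                                 ≈⟨ 1^n≈1 (n / N) ⟨
        1# ^ (n / N)                       ≈⟨ ^-congˡ (n / N) g^N≈1 ⟨
        (g ^ N) ^ (n / N)                  ≈⟨ ^-assocʳ g N (n / N) ⟩
        g ^ (N ℕ.* (n / N))                ≡⟨ cong (g ^_) (ℕ.*-comm N (n / N)) ⟩
        g ^ (n / N ℕ.* N)                  ≈⟨ *-identityʳ _ ⟨
        g ^ (n / N ℕ.* N) * 1#             ∎)

    -- Multiplication by g permutes the field and scales `e n` by g^n, which differs from 1 for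
    -- these n.
    e-elements : ∀ n → 0 < n → n < N → e n elements ≈ 0#
    e-elements n 0<n n<N = x*y≈y⇒y≈0 (λ gⁿ≈1 → ℕ.<⇒≱ n<N (N≤order n 0<n gⁿ≈1)) (begin
      g ^ n * e n elements        ≈⟨ e-scale n g elements ⟨
      e n (map (g *_) elements)   ≈⟨ e-resp-↭ n (↭-elements (Uniqueₚ.map⁺ setoid setoid (*-cancelˡ g≉0) elements!)
                                       (≡.trans (List.length-map (g *_) elements) |elements|)) ⟩
      e n elements                ∎)

    -- The sums b + ξa

    module Sumsets (m : ℕ) (1+N≡q*q : suc N ≡ (2 ℕ.+ m) ℕ.* (2 ℕ.+ m))
      (qCi×x≈0 : ∀ i → 0 < i → i < 2 ℕ.+ m → ∀ x → ((2 ℕ.+ m) C i) ×′ x ≈ 0#) where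

      open Frobenius m qCi×x≈0

      private
        q : ℕ
        q = 2 ℕ.+ m

      -- Injectivity of (b, a) ↦ b + ξa, restricted to the pairs that differ in both coordinates;
      -- the remaining pairs are settled by cancellation when ξ ≠ 0.
      Separates : Carrier → List Carrier → List Carrier → Set (c ⊔ ℓ)
      Separates ξ as bs = ∀ {a a′ b b′} → a ∈ as → a′ ∈ as → b ∈ bs → b′ ∈ bs →
                          a ≉ a′ → b ≉ b′ → ξ * (a - a′) ≉ b′ - b

      -- Pairs of positions instead of pairs of elements: distinctness of positions is propositional
      -- equality, and the index list stays the same while ξ varies.
      sum : ∀ as bs → Carrier → Fin (length bs) × Fin (length as) → Carrier
      sum as bs ξ (i , j) = lookup bs i + ξ * lookup as j

      pairs : (as bs : List Carrier) → List (Fin (length bs) × Fin (length as))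
      pairs as bs = cartesianProduct (allFin (length bs)) (allFin (length as))

      |sums| : ∀ as bs ξ → length (map (sum as bs ξ) (pairs as bs)) ≡ length bs ℕ.* length as
      |sums| as bs ξ = ≡.trans (List.length-map (sum as bs ξ) (pairs as bs))
        (≡.trans (length-cartesianProduct (allFin (length bs)) (allFin (length as)))
          (cong₂ ℕ._*_ (List.length-tabulate {n = length bs} id) (List.length-tabulate {n = length as} id)))

      sums! : ∀ {as bs ξ} → Unique as → Unique bs → ξ ≉ 0# → Separates ξ as bs →
              Unique (map (sum as bs ξ) (pairs as bs))
      sums! {as} {bs} {ξ} as! bs! ξ≉0 sep =
        Uniqueₚ.map⁺ (≡.setoid _) setoid sum-injective (PropUniqueₚ.cartesianProduct⁺ (PropUniqueₚ.allFin⁺ _) (PropUniqueₚ.allFin⁺ _))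
        where
        module _ {b b′ a a′} (eq : b + ξ * a ≈ b′ + ξ * a′) where
          difference : ξ * (a - a′) ≈ b′ - b
          difference = begin
            ξ * (a - a′)                            ≈⟨ +-identityˡ _ ⟨
            0# + ξ * (a - a′)                       ≈⟨ +-congʳ (-‿inverseʳ b) ⟨
            b - b + ξ * (a - a′)                    ≈⟨ solve 5 (λ B B₋ X A A₋ → B :+ B₋ :+ X :* (A :+ A₋) := B :+ X :* A :+ X :* A₋ :+ B₋) ≈-refl b (- b) ξ a (- a′) ⟩
            b + ξ * a + ξ * - a′ - b                ≈⟨ +-congʳ (+-congʳ eq) ⟩
            b′ + ξ * a′ + ξ * - a′ - b              ≈⟨ solve 5 (λ B B₋ X A A₋ → B :+ X :* A :+ X :* A₋ :+ B₋ := B :+ B₋ :+ X :* (A :+ A₋)) ≈-refl b′ (- b) ξ a′ (- a′) ⟩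
            b′ - b + ξ * (a′ - a′)                  ≈⟨ +-congˡ (≈-trans (*-congˡ (-‿inverseʳ a′)) (zeroʳ ξ)) ⟩
            b′ - b + 0#                             ≈⟨ +-identityʳ _ ⟩
            b′ - b                                  ∎
        sum-injective : ∀ {s t} → sum as bs ξ s ≈ sum as bs ξ t → s ≡ t
        sum-injective {i , j} {i′ , j′} eq with lookup as j ≟ lookup as j′ | lookup bs i ≟ lookup bs i′
        ... | yes a≈a′ | yes b≈b′ = cong₂ _,_ (lookup-injective bs! b≈b′) (lookup-injective as! a≈a′)
        ... | yes a≈a′ | no b≉b′ = contradiction (+-cancelʳ _ _ _ (≈-trans eq (+-congˡ (*-congˡ (≈-sym a≈a′))))) b≉b′
        ... | no a≉a′ | yes b≈b′ = contradiction (*-cancelˡ ξ≉0 (+-cancelˡ _ _ _ (≈-trans eq (+-congʳ (≈-sym b≈b′))))) a≉a′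
        ... | no a≉a′ | no b≉b′ = contradiction (difference eq)
              (sep (Membershipₚ.∈-lookup setoid as j) (Membershipₚ.∈-lookup setoid as j′)
                   (Membershipₚ.∈-lookup setoid bs i) (Membershipₚ.∈-lookup setoid bs i′) a≉a′ b≉b′)

      unique⇒length≤ : ∀ {xs} → Unique xs → length xs ≤ suc N
      unique⇒length≤ xs! = Fin.injective⇒≤ (λ eq → lookup-injective xs! (to-injective eq))

      separates-self⇒length≤q : ∀ {as ξ} → Unique as → ξ ≉ 0# → Separates ξ as as → length as ≤ q
      separates-self⇒length≤q {as} {ξ} as! ξ≉0 sep with length as ℕ.≤? q
      ... | yes |as|≤q = |as|≤q
      ... | no |as|≰q = contradiction (ℕ.≤-trans (ℕ.≤-reflexive (≡.sym (|sums| as as ξ))) (unique⇒length≤ (sums! as! as! ξ≉0 sep)))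
              (ℕ.<⇒≱ (ℕ.≤-<-trans (ℕ.≤-reflexive 1+N≡q*q) (ℕ.*-mono-< (ℕ.≰⇒> |as|≰q) (ℕ.≰⇒> |as|≰q))))

      -- For each ξ = ρ t the sums b + ξ a run through the whole field, so their n q-th elementary symmetric
      -- polynomial vanishes.  It is a polynomial in ξ of degree at most n q, with constant term (eₙ bs)^q.
      separates⇒e≈0 : ∀ {M as bs} → Unique as → Unique bs → length as ≡ q → length bs ≡ q →
                      (ρ : Fin M → Carrier) → (∀ {s t} → ρ s ≈ ρ t → s ≡ t) → (∀ t → ρ t ≉ 0#) →
                      (∀ t → Separates (ρ t) as bs) → M ≤ N → ∀ n → 0 < n → n ℕ.* q < M → e n bs ≈ 0#
      separates⇒e≈0 {M} {as} {bs} as! bs! |as| |bs| ρ ρ-inj ρ≉0 sep M≤N (suc n) 0<n nq<M = ^≈0⇒≈0 q (begin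
        e (suc n) bs ^ q
          ≡⟨ cong (λ xs → e (suc n) xs ^ q) (≡.trans (List.map-tabulate id (lookup bs)) (List.tabulate-lookup bs)) ⟨
        e (suc n) (map (lookup bs) (allFin (length bs))) ^ q
          ≈⟨ e-blocks (sum as bs 0#) (lookup bs) (λ i j → ≈-trans (+-congˡ (zeroˡ _)) (+-identityʳ _))
               (allFin (length as)) (≡.trans (List.length-tabulate id) |as|) (allFin (length bs)) (suc n) ⟨
        f 0#
          ≈⟨ DegreeBelow-roots (suc (suc n ℕ.* q)) f (e-DegreeBelow (λ (i , j) → lookup bs i) (λ (i , j) → lookup as j) (suc n ℕ.* q) (pairs as bs))
               (λ i → ρ (inject≤ i nq<M)) (λ eq → Fin.inject≤-injective _ _ _ _ (ρ-inj eq)) roots 0# ⟩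
        0# ∎)
        where
        f : Carrier → Carrier
        f ξ = e (suc n ℕ.* q) (map (sum as bs ξ) (pairs as bs))
        roots : ∀ i → f (ρ (inject≤ i nq<M)) ≈ 0#
        roots i = ≈-trans
          (e-resp-↭ (suc n ℕ.* q) (↭-elements (sums! as! bs! (ρ≉0 _) (sep _)) (≡.trans (|sums| as bs _) (≡.trans (cong₂ ℕ._*_ |bs| |as|) (≡.sym 1+N≡q*q)))))
          (e-elements (suc n ℕ.* q) z<s (ℕ.<-≤-trans nq<M M≤N))

      -- One more fixed point would give the polynomial x^q - x more than q roots. It would then
      -- vanish at g too, making g^(q - 1) = 1, although g has order q² - 1.
      ξ^q≈ξ⇒ξ∈ : ∀ {K} → Unique K → length K ≡ q → (∀ {x} → x ∈ K → x ^ q ≈ x) → ∀ {x} → x ^ q ≈ x → x ∈ K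
      ξ^q≈ξ⇒ξ∈ {K} K! |K| K-fixed {x} x^q≈x with Any.any? (x ≟_) K
      ... | yes x∈K = x∈K
      ... | no x∉K = contradiction (N≤order (1 ℕ.+ m) z<s (*-cancelˡ g≉0 (≈-trans g^q≈g (≈-sym (*-identityʳ g))))) (ℕ.<⇒≱ 1+m<N)
        where
        1+m<N : 1 ℕ.+ m < N
        1+m<N = ℕ.<-≤-trans (ℕ.m<m+n (1 ℕ.+ m) z<s) (ℕ.≤-reflexive (≡.sym (ℕ.suc-injective 1+N≡q*q)))
        f : Carrier → Carrier
        f x = x ^ q + - 1# * x
        f≈0 : ∀ {x} → x ^ q ≈ x → f x ≈ 0#
        f≈0 {x} x^q≈x = ≈-trans (+-cong x^q≈x (-1*x≈-x x)) (-‿inverseʳ x)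
        f-deg : DegreeBelow (suc q) f
        f-deg = +-DegreeBelow (suc q) (^-DegreeBelow q)
          (*-DegreeBelow (suc q) (- 1#) (DegreeBelow-resp (suc q) (λ x → ≈-sym (*-identityʳ x)) (x*-DegreeBelow q (const-DegreeBelow (1 ℕ.+ m) 1#))))
        g^q≈g : g ^ q ≈ g
        g^q≈g = x∙y⁻¹≈ε⇒x≈y _ _ (≈-trans (+-congˡ (≈-sym (-1*x≈-x g)))
          (DegreeBelow-roots (length (x ∷ K)) f (subst (λ n → DegreeBelow (suc n) f) (≡.sym |K|) f-deg) (lookup (x ∷ K))
            (lookup-injective (Allₚ.¬Any⇒All¬ K x∉K ∷ K!)) (λ { zero → f≈0 x^q≈x ; (suc i) → f≈0 (K-fixed (Membershipₚ.∈-lookup setoid K i)) }) g))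

-- For i + j = q - 1 and h = |H| this decides whether A or its reciprocals show that the i-th
-- symmetric function of A vanishes.
sum-<⇒⊎-< : ∀ i j a b {q h} → (i ℕ.+ j) ℕ.* q < (a ℕ.+ b) ℕ.* h → i ℕ.* q < a ℕ.* h ⊎ j ℕ.* q < b ℕ.* h
sum-<⇒⊎-< i j a b {q} {h} sum< with i ℕ.* q ℕ.<? a ℕ.* h | j ℕ.* q ℕ.<? b ℕ.* h
... | yes i<  | _      = inj₁ i<
... | no _    | yes j< = inj₂ j<
... | no i≮   | no j≮  = contradiction sum< (ℕ.≤⇒≯ (begin
  (a ℕ.+ b) ℕ.* h         ≡⟨ ℕ.*-distribʳ-+ h a b ⟩
  a ℕ.* h ℕ.+ b ℕ.* h     ≤⟨ ℕ.+-mono-≤ (ℕ.≮⇒≥ i≮) (ℕ.≮⇒≥ j≮) ⟩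
  i ℕ.* q ℕ.+ j ℕ.* q     ≡⟨ ℕ.*-distribʳ-+ q i j ⟨
  (i ℕ.+ j) ℕ.* q         ∎))
  where open ℕ.≤-Reasoning

-- Inverses in a finite Heyting field

module FiniteHeytingField {c ℓ₁ ℓ₂} (F : HeytingField c ℓ₁ ℓ₂) {n} (size : HasSize (FieldNotions.setoid F) n) where

  open HeytingField F using (#⇒invertible; invertible⇒#; #-irrefl; tight)
  open CommutativeRing (FieldNotions.commutativeRing F)
    renaming (refl to ≈-refl; sym to ≈-sym; trans to ≈-trans)
  open RingProperties ring using (-0#≈0#)
  open UniqueLists setoid
  open Finite size

  1≉0 : 1# ≉ 0#
  1≉0 1≈0 = #-irrefl ≈-refl (invertible⇒# {0#} {0#} (1# , all≈1 _ , all≈1 _))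
    where
    all≈1 : ∀ x → x ≈ 1#
    all≈1 x = ≈-trans (≈-sym (*-identityʳ x)) (≈-trans (*-congˡ 1≈0) (≈-trans (zeroʳ x) (≈-sym 1≈0)))

  -- Tightness only refutes ¬ (x # 0). A search through the finitely many candidates decides
  -- invertibility and so turns this into an actual inverse.
  inverse : ∀ x → x ≉ 0# → ∃[ y ] x * y ≈ 1#
  inverse x x≉0 with Fin.any? (λ i → x * from i ≟ 1#)
  ... | yes (i , xy≈1) = from i , xy≈1
  ... | no ¬inv = contradiction (proj₁ (tight x 0#) ¬x#0) x≉0
    where
    ¬x#0 : ¬ HeytingField._#_ F x 0#
    ¬x#0 x#0 with #⇒invertible x#0
    ... | y , _ , [x-0]y≈1 = ¬inv (to y , (begin
      x * from (to y)  ≈⟨ *-congˡ (from-to y) ⟩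
      x * y            ≈⟨ *-congʳ (≈-trans (+-congˡ -0#≈0#) (+-identityʳ x)) ⟨
      (x - 0#) * y     ≈⟨ [x-0]y≈1 ⟩
      1#               ∎))
      where open SetoidReasoning setoid

-- Cosets of H, indexed by exponents of g modulo d

module Cosets {c ℓ₁ ℓ₂ h} (F : HeytingField c ℓ₁ ℓ₂) (N : ℕ) (size : HasSize (FieldNotions.setoid F) (suc N))
  (H : Pred (FieldNotions.Carrier F) h) (H-subgroup : FieldNotions.IsSubgroup* F H)
  (d₁ : ℕ) (index : FieldNotions.HasIndex* F H (suc d₁))
  (g : FieldNotions.Carrier F) (g-generator : FieldNotions.IsGenerator* F g)
  where

  open FieldNotions F using (commutativeRing; module IsSubgroup*; _·_; affine; cosets; cosetUnion)
  open CommutativeRing commutativeRing hiding (zero)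
    renaming (refl to ≈-refl; sym to ≈-sym; trans to ≈-trans)
  open Exp semiring using (_^_; ^-congˡ; ^-congʳ; ^-homo-*; ^-assocʳ)
  open CommExp commutativeSemiring using (^-distrib-*)
  open Mult semiring using () renaming (_×_ to _×′_)
  open RingProperties ring using (-‿distribˡ-*; -‿involutive; -0#≈0#; +-cancelʳ; x∙y⁻¹≈ε⇒x≈y)
  open Membership setoid using (_∈_)
  open UniqueSetoid setoid using (Unique)
  open Permutation setoid using (_↭_; ↭-sym)
  open PermutationProperties setoid using (∈-resp-↭)
  open RingTheory commutativeRing
  open SemiringSolver commutativeSemiring using (solve; _:+_; _:*_; _:=_)
  open SetoidReasoning setoid
  open FiniteHeytingField F size using (1≉0; inverse)
  open FiniteField commutativeRing N size 1≉0 inverse public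
  open IsSubgroup* H-subgroup public using () renaming (resp to H-resp; nonzero to H-nonzero; 1-mem to 1∈H; *-closed to H-*; inv-closed to H-inv-closed)

  g≉0 : g ≉ 0#
  g≉0 = proj₁ g-generator

  log : ∀ x → x ≉ 0# → ∃[ n ] x ≈ g ^ n
  log = proj₂ g-generator

  open Generator g g≉0 log public

  d : ℕ
  d = suc d₁

  private
    module CosetsFinite = UniqueLists.Finite (cosets H) index

  H-^ : ∀ {x} n → H x → H (x ^ n)
  H-^ zero    Hx = 1∈H
  H-^ (suc n) Hx = H-* Hx (H-^ n Hx)

  H-inv : ∀ {x} → H x → H (inv x)
  H-inv Hx = H-inv-closed Hx (*-inv (H-nonzero Hx))

  coset-resp : ∀ n {x y} → x ≈ y → (g ^ n · H) x → (g ^ n · H) y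
  coset-resp n x≈y (η , Hη , x≈) = η , Hη , ≈-trans (≈-sym x≈y) x≈

  coset-≉0 : ∀ n {x} → (g ^ n · H) x → x ≉ 0#
  coset-≉0 n (η , Hη , x≈) x≈0 = x*y≉0 (^≉0 n g≉0) (H-nonzero Hη) (≈-trans (≈-sym x≈) x≈0)

  coset-* : ∀ i j {x y} → (g ^ i · H) x → (g ^ j · H) y → (g ^ (i ℕ.+ j) · H) (x * y)
  coset-* i j {x} {y} (η , Hη , x≈) (θ , Hθ , y≈) = η * θ , H-* Hη Hθ , (begin
    x * y                        ≈⟨ *-cong x≈ y≈ ⟩
    g ^ i * η * (g ^ j * θ)      ≈⟨ solve 4 (λ A B C D → A :* B :* (C :* D) := A :* C :* (B :* D)) ≈-refl (g ^ i) η (g ^ j) θ ⟩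
    g ^ i * g ^ j * (η * θ)      ≈⟨ *-congʳ (^-homo-* g i j) ⟨
    g ^ (i ℕ.+ j) * (η * θ)      ∎)

  H⇒coset-0 : ∀ {x} → H x → (g ^ 0 · H) x
  H⇒coset-0 {x} Hx = x , Hx , ≈-sym (*-identityˡ x)

  same-coset⇒⊆ : ∀ n {x y z} → (g ^ n · H) x → (g ^ n · H) y → (x · H) z → (y · H) z
  same-coset⇒⊆ n {x} {y} {z} (η , Hη , x≈) (θ , Hθ , y≈) (ζ , Hζ , z≈) = inv θ * η * ζ , H-* (H-* (H-inv Hθ) Hη) Hζ , (begin
    z                                ≈⟨ z≈ ⟩
    x * ζ                            ≈⟨ *-congʳ x≈ ⟩
    g ^ n * η * ζ                    ≈⟨ *-identityˡ _ ⟨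
    1# * (g ^ n * η * ζ)             ≈⟨ *-congʳ (*-inv (H-nonzero Hθ)) ⟨
    θ * inv θ * (g ^ n * η * ζ)      ≈⟨ solve 5 (λ T I G E Z → T :* I :* (G :* E :* Z) := G :* T :* (I :* E :* Z)) ≈-refl θ (inv θ) (g ^ n) η ζ ⟩
    g ^ n * θ * (inv θ * η * ζ)      ≈⟨ *-congʳ y≈ ⟨
    y * (inv θ * η * ζ)              ∎)

  coset-% : ∀ {x} r t → H (g ^ suc r) → x ≈ g ^ t → (g ^ (t % suc r) · H) x
  coset-% {x} r t Hgʳ x≈gᵗ = g ^ (t / suc r ℕ.* suc r) ,
    H-resp (≈-trans (^-assocʳ g (suc r) (t / suc r)) (^-congʳ g (ℕ.*-comm (suc r) (t / suc r)))) (H-^ (t / suc r) Hgʳ) , (begin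
    x                                                ≈⟨ x≈gᵗ ⟩
    g ^ t                                            ≡⟨ cong (g ^_) (m≡m%n+[m/n]*n t (suc r)) ⟩
    g ^ (t % suc r ℕ.+ t / suc r ℕ.* suc r)          ≈⟨ ^-homo-* g (t % suc r) _ ⟩
    g ^ (t % suc r) * g ^ (t / suc r ℕ.* suc r)      ∎)

  -- If g^r lies in H, the coset of g^t depends only on t modulo r, so there are at most r cosets.
  g^r∈H⇒d≤r : ∀ r → 0 < r → H (g ^ r) → d ≤ r
  g^r∈H⇒d≤r (suc r) _ Hgʳ with d ℕ.≤? suc r
  ... | yes d≤r = d≤r
  ... | no d≰r = contradiction f-injective (CosetsFinite.coincidence (ℕ.≰⇒> d≰r) f)
    where
    f : Σ Carrier (_≉ 0#) → Fin (suc r)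
    f (x , x≉0) = fromℕ< (m%n<n (proj₁ (log x x≉0)) (suc r))
    f-injective : ∀ x y → f x ≡ f y → Setoid._≈_ (cosets H) x y
    f-injective (x , x≉0) (y , y≉0) eq with log x x≉0 | log y y≉0
    ... | s , x≈gˢ | t , y≈gᵗ = same-coset⇒⊆ (s % suc r) x∈ y∈ , same-coset⇒⊆ (s % suc r) y∈ x∈
      where
      x∈ : (g ^ (s % suc r) · H) x
      x∈ = coset-% r s Hgʳ x≈gˢ
      y∈ : (g ^ (s % suc r) · H) y
      y∈ = subst (λ n → (g ^ n · H) y) (≡.sym (Fin.fromℕ<-injective _ _ _ _ eq)) (coset-% r t Hgʳ y≈gᵗ)

  -- The quotient g^(j - i) lies in H, so j - i ≥ d by `g^r∈H⇒d≤r`; as j ≤ d, equality holds.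
  g^i-coset≐g^j-coset⇒g^d∈H : ∀ i j → i < j → j ≤ d → (g ^ i · H) ≐ (g ^ j · H) → H (g ^ d)
  g^i-coset≐g^j-coset⇒g^d∈H i j i<j j≤d (_ , ⊇) = subst (λ n → H (g ^ n)) j∸i≡d Hgʲ⁻ⁱ
    where
    Hgʲ⁻ⁱ : H (g ^ (j ℕ.∸ i))
    Hgʲ⁻ⁱ with ⊇ (1# , 1∈H , ≈-sym (*-identityʳ (g ^ j)))
    ... | η , Hη , gʲ≈gⁱη = H-resp (*-cancelˡ (^≉0 i g≉0) (begin
      g ^ i * η                    ≈⟨ gʲ≈gⁱη ⟨
      g ^ j                        ≡⟨ cong (g ^_) (ℕ.m+[n∸m]≡n (ℕ.<⇒≤ i<j)) ⟨
      g ^ (i ℕ.+ (j ℕ.∸ i))        ≈⟨ ^-homo-* g i _ ⟩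
      g ^ i * g ^ (j ℕ.∸ i)        ∎)) Hη
    j∸i≡d : j ℕ.∸ i ≡ d
    j∸i≡d = ℕ.≤-antisym (ℕ.≤-trans (ℕ.m∸n≤m j i) j≤d) (g^r∈H⇒d≤r (j ℕ.∸ i) (ℕ.m<n⇒0<n∸m i<j) Hgʲ⁻ⁱ)

  g^d∈H : H (g ^ d)
  g^d∈H = let i , j , i<j , eq = CosetsFinite.collision ℕ.≤-refl (λ (i : Fin (suc d)) → g ^ toℕ i , ^≉0 (toℕ i) g≉0)
          in g^i-coset≐g^j-coset⇒g^d∈H (toℕ i) (toℕ j) i<j (s≤s⁻¹ (Fin.toℕ<n j)) eq

  coset-disjoint : ∀ i j {x} → i < j → j < d → (g ^ i · H) x → ¬ (g ^ j · H) x
  coset-disjoint i j {x} i<j j<d (η , Hη , x≈) (θ , Hθ , x≈′) =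
    ℕ.<⇒≱ (ℕ.≤-<-trans (ℕ.m∸n≤m j i) j<d) (g^r∈H⇒d≤r (j ℕ.∸ i) (ℕ.m<n⇒0<n∸m i<j) (H-resp gʲ⁻ⁱ (H-* Hη (H-inv Hθ))))
    where
    gʲ⁻ⁱ : η * inv θ ≈ g ^ (j ℕ.∸ i)
    gʲ⁻ⁱ = *-cancelˡ (^≉0 i g≉0) (begin
      g ^ i * (η * inv θ)                  ≈⟨ *-assoc _ _ _ ⟨
      g ^ i * η * inv θ                    ≈⟨ *-congʳ (≈-trans (≈-sym x≈) x≈′) ⟩
      g ^ j * θ * inv θ                    ≈⟨ *-assoc _ _ _ ⟩
      g ^ j * (θ * inv θ)                  ≈⟨ *-congˡ (*-inv (H-nonzero Hθ)) ⟩
      g ^ j * 1#                           ≈⟨ *-identityʳ _ ⟩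
      g ^ j                                ≡⟨ cong (g ^_) (ℕ.m+[n∸m]≡n (ℕ.<⇒≤ i<j)) ⟨
      g ^ (i ℕ.+ (j ℕ.∸ i))                ≈⟨ ^-homo-* g i _ ⟩
      g ^ i * g ^ (j ℕ.∸ i)                ∎)

  coset-unique : ∀ i j {x} → i < d → j < d → (g ^ i · H) x → (g ^ j · H) x → i ≡ j
  coset-unique i j i<d j<d x∈i x∈j with ℕ.<-cmp i j
  ... | tri≈ _ i≡j _ = i≡j
  ... | tri< i<j _ _ = contradiction x∈j (coset-disjoint i j i<j j<d x∈i)
  ... | tri> _ _ j<i = contradiction x∈i (coset-disjoint j i j<i i<d x∈j)

  coset-drop-d : ∀ n {x} → (g ^ (d ℕ.+ n) · H) x → (g ^ n · H) x
  coset-drop-d n {x} (η , Hη , x≈) = g ^ d * η , H-* g^d∈H Hη , (begin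
    x                        ≈⟨ x≈ ⟩
    g ^ (d ℕ.+ n) * η        ≈⟨ *-congʳ (^-homo-* g d n) ⟩
    g ^ d * g ^ n * η        ≈⟨ solve 3 (λ A B C → A :* B :* C := B :* (A :* C)) ≈-refl (g ^ d) (g ^ n) η ⟩
    g ^ n * (g ^ d * η)      ∎)

  |H| : ℕ
  |H| = N / d

  -- H is never enumerated: g^N = 1 lies in the coset of index N modulo d and in that of index 0, so
  -- d divides N.
  N≡|H|*d : N ≡ |H| ℕ.* d
  N≡|H|*d = ≡.trans (m≡m%n+[m/n]*n N d) (cong (ℕ._+ |H| ℕ.* d)
    (coset-unique (N % d) 0 (m%n<n N d) z<s (coset-% d₁ N g^d∈H ≈-refl) (H⇒coset-0 (H-resp (≈-sym g^N≈1) 1∈H))))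

  cosetUnion-resp : ∀ {n x y} → x ≈ y → cosetUnion g H n x → cosetUnion g H n y
  cosetUnion-resp x≈y (j , j≤n , x∈) = j , j≤n , coset-resp j x≈y x∈

  cosetUnion-≉0 : ∀ {n x} → cosetUnion g H n x → x ≉ 0#
  cosetUnion-≉0 (j , _ , x∈) = coset-≉0 j x∈

  cosetUnion-* : ∀ {m n x y} → cosetUnion g H m x → cosetUnion g H n y → cosetUnion g H (m ℕ.+ n) (x * y)
  cosetUnion-* (i , i≤m , x∈) (j , j≤n , y∈) = i ℕ.+ j , ℕ.+-mono-≤ i≤m j≤n , coset-* i j x∈ y∈

  cosetUnion? : ∀ {n} → n < d → ∀ x → Dec (cosetUnion g H n x)
  cosetUnion? {n} n<d x with x ≟ 0#
  ... | yes x≈0 = no λ x∈ → cosetUnion-≉0 x∈ x≈0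
  ... | no x≉0 with log x x≉0
  ...   | t , x≈gᵗ with t % d ℕ.≤? n
  ...     | yes t%d≤n = yes (t % d , t%d≤n , coset-% d₁ t g^d∈H x≈gᵗ)
  ...     | no t%d≰n = no λ (j , j≤n , x∈) → t%d≰n (subst (_≤ n)
              (coset-unique j (t % d) (ℕ.≤-<-trans j≤n n<d) (m%n<n t d) x∈ (coset-% d₁ t g^d∈H x≈gᵗ)) j≤n)

  -- The elements g^(1 + k + r + t d) with r < M and t < |H|: they fill the cosets gᵏ⁺¹H, …, gᵏ⁺ᴹH.
  module Gap (k M : ℕ) where

    exponent : Fin M × Fin |H| → ℕ
    exponent (r , t) = suc k ℕ.+ toℕ r ℕ.+ toℕ t ℕ.* d

    ρ : Fin (M ℕ.* |H|) → Carrier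
    ρ i = g ^ exponent (remQuot |H| i)

    ρ≉0 : ∀ i → ρ i ≉ 0#
    ρ≉0 i = ^≉0 (exponent (remQuot |H| i)) g≉0

    ρ-coset : ∀ i → (g ^ (suc k ℕ.+ toℕ (proj₁ (remQuot {M} |H| i))) · H) (ρ i)
    ρ-coset i = g ^ (toℕ t ℕ.* d) , H-resp (≈-trans (^-assocʳ g d (toℕ t)) (^-congʳ g (ℕ.*-comm d (toℕ t)))) (H-^ (toℕ t) g^d∈H) ,
      ^-homo-* g (suc k ℕ.+ toℕ (proj₁ (remQuot {M} |H| i))) (toℕ t ℕ.* d)
      where
      t : Fin |H|
      t = proj₂ (remQuot {M} |H| i)

    ρ-residue<d : k ℕ.+ M < d → ∀ (r : Fin M) → suc k ℕ.+ toℕ r < d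
    ρ-residue<d k+M<d r = ℕ.≤-<-trans (ℕ.≤-trans (ℕ.≤-reflexive (≡.sym (ℕ.+-suc k (toℕ r)))) (ℕ.+-monoʳ-≤ k (Fin.toℕ<n r))) k+M<d

    ρ-injective : k ℕ.+ M < d → ∀ {i j} → ρ i ≈ ρ j → i ≡ j
    ρ-injective k+M<d {i} {j} ρi≈ρj = ≡.trans (≡.sym (Fin.combine-remQuot {M} |H| i))
      (≡.trans (cong₂ combine (Fin.toℕ-injective residues≡) (Fin.toℕ-injective quotients≡)) (Fin.combine-remQuot {M} |H| j))
      where
      exponent<N : ∀ p → exponent p < N
      exponent<N (r , t) = ℕ.<-≤-trans (ℕ.+-monoˡ-< (toℕ t ℕ.* d) (ρ-residue<d k+M<d r))
        (ℕ.≤-trans (ℕ.*-monoˡ-≤ d (Fin.toℕ<n t)) (ℕ.≤-reflexive (≡.sym N≡|H|*d)))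
      residues≡ : toℕ (proj₁ (remQuot {M} |H| i)) ≡ toℕ (proj₁ (remQuot {M} |H| j))
      residues≡ = ℕ.+-cancelˡ-≡ (suc k) _ _ (coset-unique _ _ (ρ-residue<d k+M<d _) (ρ-residue<d k+M<d _) (coset-resp (suc k ℕ.+ toℕ (proj₁ (remQuot {M} |H| i))) ρi≈ρj (ρ-coset i)) (ρ-coset j))
      quotients≡ : toℕ (proj₂ (remQuot {M} |H| i)) ≡ toℕ (proj₂ (remQuot {M} |H| j))
      quotients≡ = ℕ.*-cancelʳ-≡ _ _ d (ℕ.+-cancelˡ-≡ (suc k ℕ.+ toℕ (proj₁ (remQuot {M} |H| j))) _ _
        (≡.trans (cong (λ r → suc k ℕ.+ r ℕ.+ toℕ (proj₂ (remQuot {M} |H| i)) ℕ.* d) (≡.sym residues≡)) (^-injective (exponent<N (remQuot {M} |H| i)) (exponent<N (remQuot {M} |H| j)) ρi≈ρj)))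

    -- Indices add under multiplication. The product ρx has an index from k + 1 to k + M + l, which
    -- is still below d, so no reduction modulo d brings it back into 0, ..., k.
    ρ-avoids : ∀ {l} → k ℕ.+ M ℕ.+ l < d → ∀ i {x y} → cosetUnion g H l x → cosetUnion g H k y → ρ i * x ≉ y
    ρ-avoids {l} k+M+l<d i {x} {y} (a , a≤l , x∈) (b , b≤k , y∈) ρx≈y = ℕ.<⇒≱ (s≤s (ℕ.≤-trans (ℕ.m≤m+n k _) (ℕ.m≤m+n _ a))) (subst (_≤ k) b≡ b≤k)
      where
      r : ℕ
      r = toℕ (proj₁ (remQuot {M} |H| i))
      r+a<d : suc k ℕ.+ r ℕ.+ a < d
      r+a<d = ℕ.≤-<-trans (ℕ.+-mono-≤ (ℕ.≤-trans (ℕ.≤-reflexive (≡.sym (ℕ.+-suc k r))) (ℕ.+-monoʳ-≤ k (Fin.toℕ<n (proj₁ (remQuot {M} |H| i))))) a≤l) k+M+l<d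
      b≡ : b ≡ suc k ℕ.+ r ℕ.+ a
      b≡ = coset-unique b (suc k ℕ.+ r ℕ.+ a) (ℕ.≤-<-trans b≤k (ℕ.≤-<-trans (ℕ.≤-trans (ℕ.m≤m+n k M) (ℕ.m≤m+n _ l)) k+M+l<d)) r+a<d y∈
             (coset-resp (suc k ℕ.+ r ℕ.+ a) ρx≈y (coset-* (suc k ℕ.+ r) a (ρ-coset i) x∈))

  -- Cliques of size q when d = 6k + 2 + r

  module LargeCliques (k r : ℕ) (d≡6k+2+r : suc d₁ ≡ 6 ℕ.* k ℕ.+ 2 ℕ.+ r)
    (m : ℕ) (1+N≡q*q : suc N ≡ (2 ℕ.+ m) ℕ.* (2 ℕ.+ m))
    (qCi×x≈0 : ∀ i → 0 < i → i < 2 ℕ.+ m → ∀ x → ((2 ℕ.+ m) C i) ×′ x ≈ 0#)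
    {κ} (K : Pred Carrier κ) (K-subfield : FieldNotions.IsSubfield F K)
    (K-size : HasSize (subsetoid setoid K) (2 ℕ.+ m))
    where

    open Sumsets m 1+N≡q*q qCi×x≈0
    open FieldNotions.IsSubfield K-subfield public using ()
      renaming (resp to K-resp; 0-mem to 0∈K; 1-mem to 1∈K; neg-closed to K-neg; +-closed to K-+; *-closed to K-*)

    q : ℕ
    q = 2 ℕ.+ m

    S : Pred Carrier (c ⊔ ℓ₁ ⊔ h)
    S = cosetUnion g H k

    open Cliques setoid (Cay +-abelianGroup S) using (IsClique)

    N≡[1+m]*[1+q] : N ≡ suc m ℕ.* suc q
    N≡[1+m]*[1+q] = ≡.trans (ℕ.suc-injective 1+N≡q*q) (≡.sym (ℕ.*-suc (suc m) q))

    instance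
      N-nonZero : NonZero N
      N-nonZero = subst NonZero (≡.sym N≡[1+m]*[1+q]) _

    |H|>0 : 0 < |H|
    |H|>0 with |H| in |H|≡
    ... | suc _ = z<s
    ... | zero  = contradiction (≡.trans N≡|H|*d (cong (ℕ._* d) |H|≡)) (ℕ.≢-nonZero⁻¹ N)

    module _ {e} (6k+2+r≡1+e : 6 ℕ.* k ℕ.+ 2 ℕ.+ r ≡ suc e) where
      ≤e⇒<d : ∀ {n} → n ≤ e → n < d
      ≤e⇒<d n≤e = ℕ.≤-trans (s≤s n≤e) (ℕ.≤-reflexive (≡.sym (≡.trans d≡6k+2+r 6k+2+r≡1+e)))

    2k<d : k ℕ.+ k < d
    2k<d = ≤e⇒<d (split k r) (ℕ.m≤m+n (k ℕ.+ k) _)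
      where
      split : ∀ k r → 6 ℕ.* k ℕ.+ 2 ℕ.+ r ≡ suc (k ℕ.+ k ℕ.+ (4 ℕ.* k ℕ.+ 1 ℕ.+ r))
      split = ℕSolver.solve-∀

    k<d : k < d
    k<d = ℕ.≤-<-trans (ℕ.m≤m+n k k) 2k<d

    Differences : List Carrier → Set (c ⊔ ℓ₁ ⊔ h)
    Differences as = ∀ {a a′} → a ∈ as → a′ ∈ as → a ≉ a′ → S (a - a′)

    differences⇒separates : ∀ {M as} → k ℕ.+ M ℕ.+ k < d → Differences as → ∀ i → Separates (Gap.ρ k M i) as as
    differences⇒separates {M} bound diff i a∈ a′∈ b∈ b′∈ a≉a′ b≉b′ =
      Gap.ρ-avoids k M bound i (diff a∈ a′∈ a≉a′) (diff b′∈ b∈ (b≉b′ ∘ ≈-sym))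

    -- A single admissible scalar is enough, so one coset is taken, M = 1, and any element of it
    -- serves.
    clique⇒length≤q : ∀ {xs} → IsClique xs → length xs ≤ q
    clique⇒length≤q {xs} (xs! , adjacent) = separates-self⇒length≤q xs! (Gap.ρ≉0 k 1 i) (differences⇒separates bound adjacent i)
      where
      i : Fin (1 ℕ.* |H|)
      i = fromℕ< (ℕ.<-≤-trans |H|>0 (ℕ.m≤m+n |H| 0))
      split : ∀ k r → 6 ℕ.* k ℕ.+ 2 ℕ.+ r ≡ suc (k ℕ.+ 1 ℕ.+ k ℕ.+ (4 ℕ.* k ℕ.+ r))
      split = ℕSolver.solve-∀
      bound : k ℕ.+ 1 ℕ.+ k < d
      bound = ≤e⇒<d (split k r) (ℕ.m≤m+n (k ℕ.+ 1 ℕ.+ k) _)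

    -- The numbers of cosets of H available as scalars for A + ξA and for B + ξA, where B = {0} ∪ {1/a : 0 ≠ a ∈ A}.
    M₀ M₁ : ℕ
    M₀ = 4 ℕ.* k ℕ.+ 1 ℕ.+ r
    M₁ = 2 ℕ.* k ℕ.+ 1 ℕ.+ r

    M₀-bound : k ℕ.+ M₀ ℕ.+ k < d
    M₀-bound = ≤e⇒<d (split k r) ℕ.≤-refl
      where
      split : ∀ k r → 6 ℕ.* k ℕ.+ 2 ℕ.+ r ≡ suc (k ℕ.+ (4 ℕ.* k ℕ.+ 1 ℕ.+ r) ℕ.+ k)
      split = ℕSolver.solve-∀

    M₁-bound : k ℕ.+ M₁ ℕ.+ (k ℕ.+ (k ℕ.+ k)) < d
    M₁-bound = ≤e⇒<d (split k r) ℕ.≤-refl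
      where
      split : ∀ k r → 6 ℕ.* k ℕ.+ 2 ℕ.+ r ≡ suc (k ℕ.+ (2 ℕ.* k ℕ.+ 1 ℕ.+ r) ℕ.+ (k ℕ.+ (k ℕ.+ k)))
      split = ℕSolver.solve-∀

    d≤M₀+M₁ : d ≤ M₀ ℕ.+ M₁
    d≤M₀+M₁ = ℕ.≤-trans (ℕ.≤-reflexive d≡6k+2+r) (ℕ.≤-trans (ℕ.m≤m+n _ r) (ℕ.≤-reflexive (split k r)))
      where
      split : ∀ k r → 6 ℕ.* k ℕ.+ 2 ℕ.+ r ℕ.+ r ≡ 4 ℕ.* k ℕ.+ 1 ℕ.+ r ℕ.+ (2 ℕ.* k ℕ.+ 1 ℕ.+ r)
      split = ℕSolver.solve-∀

    k+M<d : ∀ {M l} → k ℕ.+ M ℕ.+ l < d → k ℕ.+ M < d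
    k+M<d {M} {l} = ℕ.≤-<-trans (ℕ.m≤m+n (k ℕ.+ M) l)

    M*|H|≤N : ∀ {M l} → k ℕ.+ M ℕ.+ l < d → M ℕ.* |H| ≤ N
    M*|H|≤N {M} {l} bound = ℕ.≤-trans (ℕ.*-monoˡ-≤ |H| (ℕ.≤-trans (ℕ.m≤n+m M k) (ℕ.<⇒≤ (k+M<d {M} {l} bound))))
      (ℕ.≤-reflexive (≡.trans (ℕ.*-comm d |H|) (≡.sym N≡|H|*d)))

    [1+m]*q<[M₀+M₁]*|H| : suc m ℕ.* q < (M₀ ℕ.+ M₁) ℕ.* |H|
    -- The number q² - 1 exceeds (q - 1)q by q - 1, which is `suc m`.
    [1+m]*q<[M₀+M₁]*|H| = ℕ.<-≤-trans (ℕ.m<n+m (suc m ℕ.* q) {suc m} z<s)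
      (ℕ.≤-trans (ℕ.≤-reflexive (≡.trans (≡.sym (ℕ.suc-injective 1+N≡q*q)) (≡.trans N≡|H|*d (ℕ.*-comm |H| d))))
        (ℕ.*-monoˡ-≤ |H| d≤M₀+M₁))

    -- The subfield as the set of fixed points of x ↦ x^q

    private
      module KFinite = UniqueLists.Finite (subsetoid setoid K) K-size

    K-elements : List Carrier
    K-elements = map proj₁ KFinite.elements

    K-elements! : Unique K-elements
    K-elements! = Uniqueₚ.map⁺ (subsetoid setoid K) setoid id KFinite.elements!

    |K-elements| : length K-elements ≡ q
    |K-elements| = ≡.trans (List.length-map proj₁ KFinite.elements) KFinite.|elements|

    K⇒∈ : ∀ {x} → K x → x ∈ K-elements
    K⇒∈ {x} Kx = Membershipₚ.∈-map⁺ (subsetoid setoid K) setoid {f = proj₁} id {v = x , Kx} {xs = KFinite.elements} (KFinite.∈-elements (x , Kx))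

    ∈⇒K : ∀ {x} → x ∈ K-elements → K x
    ∈⇒K {x} x∈ = let (y , Ky) , _ , x≈y = Membershipₚ.∈-map⁻ (subsetoid setoid K) setoid {v = x} {xs = KFinite.elements} {f = proj₁} x∈ in K-resp (≈-sym x≈y) Ky

    K⇒^≈1 : ∀ {x} → K x → x ≉ 0# → x ^ suc m ≈ 1#
    K⇒^≈1 Kx x≉0 = lagrange K-elements! |K-elements| (K⇒∈ 0∈K) x≉0 (λ y∈ → K⇒∈ (K-* Kx (∈⇒K y∈)))

    ^≈1⇒^q≈ : ∀ {x} → x ^ suc m ≈ 1# → x ^ q ≈ x
    ^≈1⇒^q≈ x^≈1 = ≈-trans (*-congˡ x^≈1) (*-identityʳ _)

    K⇒^q≈ : ∀ {x} → K x → x ^ q ≈ x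
    K⇒^q≈ {x} Kx with x ≟ 0#
    ... | yes x≈0 = ≈-trans (*-congʳ x≈0) (≈-trans (zeroˡ _) (≈-sym x≈0))
    ... | no x≉0  = ^≈1⇒^q≈ (K⇒^≈1 Kx x≉0)

    ^q≈⇒K : ∀ {x} → x ^ q ≈ x → K x
    ^q≈⇒K x^q≈x = ∈⇒K (ξ^q≈ξ⇒ξ∈ K-elements! |K-elements| (K⇒^q≈ ∘ ∈⇒K) x^q≈x)

    -- A clique with q elements is a line

    module Line (x₀ x₁ : Carrier) (xs : List Carrier) (|xs|≡m : length xs ≡ m) (clique : IsClique (x₀ ∷ x₁ ∷ xs)) where

      A tail B : List Carrier
      A    = map (_- x₀) (x₀ ∷ x₁ ∷ xs)
      tail = map (_- x₀) (x₁ ∷ xs)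
      B    = map inv A

      |tail| : length tail ≡ suc m
      |tail| = cong suc (≡.trans (List.length-map (_- x₀) xs) |xs|≡m)

      |A| : length A ≡ q
      |A| = cong suc |tail|

      |B| : length B ≡ q
      |B| = ≡.trans (List.length-map inv A) |A|

      A! : Unique A
      A! = Uniqueₚ.map⁺ setoid setoid (+-cancelʳ (- x₀) _ _) (proj₁ clique)

      B! : Unique B
      B! = Uniqueₚ.map⁺ setoid setoid inv-injective A!

      A-differences : Differences A
      A-differences {a} {a′} a∈ a′∈ a≉a′ with Membershipₚ.∈-map⁻ setoid setoid a∈ | Membershipₚ.∈-map⁻ setoid setoid a′∈
      ... | x , x∈ , a≈ | x′ , x′∈ , a′≈ = cosetUnion-resp
        (≈-sym (≈-trans (+-cong a≈ (-‿cong a′≈)) ([x-z]-[y-z]≈x-y x x′ x₀)))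
        (proj₂ clique x∈ x′∈ (λ x≈x′ → a≉a′ (≈-trans a≈ (≈-trans (+-congʳ x≈x′) (≈-sym a′≈)))))

      A-nonzero⇒S : ∀ {a} → a ∈ A → a ≉ 0# → S a
      A-nonzero⇒S {a} a∈ a≉0 = cosetUnion-resp (≈-trans (+-congˡ (≈-trans (-‿cong (-‿inverseʳ x₀)) -0#≈0#)) (+-identityʳ a))
        (A-differences a∈ (here ≈-refl) (λ a≈ → a≉0 (≈-trans a≈ (-‿inverseʳ x₀))))

      -- The factor u clears denominators and is a product of two elements of S, hence the bound 2k
      -- on its index. If one of y and y′ is 0, a single reciprocal remains up to sign, and the
      -- square of the other element turns it into that element up to the same sign.
      reciprocal-difference : ∀ {y y′} → y ∈ A → y′ ∈ A → y ≉ y′ →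
                              ∃[ u ] cosetUnion g H (k ℕ.+ k) u × S ((inv y′ - inv y) * u)
      reciprocal-difference {y} {y′} y∈ y′∈ y≉y′ with y ≟ 0# | y′ ≟ 0#
      ... | yes y≈0 | yes y′≈0 = contradiction (≈-trans y≈0 (≈-sym y′≈0)) y≉y′
      ... | yes y≈0 | no y′≉0 = y′ * y′ , cosetUnion-* Sy′ Sy′ , cosetUnion-resp (≈-sym (begin
        (inv y′ - inv y) * (y′ * y′)   ≈⟨ *-congʳ (≈-trans (+-congˡ (≈-trans (-‿cong (inv-0 y≈0)) -0#≈0#)) (+-identityʳ _)) ⟩
        inv y′ * (y′ * y′)             ≈⟨ solve 2 (λ I Y → I :* (Y :* Y) := Y :* I :* Y) ≈-refl (inv y′) y′ ⟩
        y′ * inv y′ * y′               ≈⟨ *-congʳ (*-inv y′≉0) ⟩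
        1# * y′                        ≈⟨ *-identityˡ y′ ⟩
        y′                             ∎)) Sy′
        where
        Sy′ : S y′
        Sy′ = A-nonzero⇒S y′∈ y′≉0
      ... | no y≉0 | yes y′≈0 = y * y , cosetUnion-* Sy Sy , cosetUnion-resp (≈-sym (begin
        (inv y′ - inv y) * (y * y)     ≈⟨ *-congʳ (≈-trans (+-congʳ (inv-0 y′≈0)) (+-identityˡ _)) ⟩
        - inv y * (y * y)              ≈⟨ -‿distribˡ-* (inv y) (y * y) ⟨
        - (inv y * (y * y))            ≈⟨ -‿cong (solve 2 (λ I Y → I :* (Y :* Y) := Y :* I :* Y) ≈-refl (inv y) y) ⟩
        - (y * inv y * y)              ≈⟨ -‿cong (≈-trans (*-congʳ (*-inv y≉0)) (*-identityˡ y)) ⟩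
        - y                            ≈⟨ +-identityˡ _ ⟨
        0# - y                         ≈⟨ +-congʳ y′≈0 ⟨
        y′ - y                         ∎)) (A-differences y′∈ y∈ (y≉y′ ∘ ≈-sym))
        where
        Sy : S y
        Sy = A-nonzero⇒S y∈ y≉0
      ... | no y≉0 | no y′≉0 = y * y′ , cosetUnion-* (A-nonzero⇒S y∈ y≉0) (A-nonzero⇒S y′∈ y′≉0) , cosetUnion-resp (≈-sym (begin
        (inv y′ - inv y) * (y * y′)                  ≈⟨ distribʳ (y * y′) (inv y′) (- inv y) ⟩
        inv y′ * (y * y′) + - inv y * (y * y′)       ≈⟨ +-congˡ (-‿distribˡ-* (inv y) (y * y′)) ⟨
        inv y′ * (y * y′) - inv y * (y * y′)         ≈⟨ +-cong (solve 3 (λ I Y Z → I :* (Y :* Z) := Z :* I :* Y) ≈-refl (inv y′) y y′)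
                                                          (-‿cong (solve 3 (λ I Y Z → I :* (Y :* Z) := Y :* I :* Z) ≈-refl (inv y) y y′)) ⟩
        y′ * inv y′ * y - y * inv y * y′             ≈⟨ +-cong (≈-trans (*-congʳ (*-inv y′≉0)) (*-identityˡ y)) (-‿cong (≈-trans (*-congʳ (*-inv y≉0)) (*-identityˡ y′))) ⟩
        y - y′                                       ∎)) (A-differences y∈ y′∈ y≉y′)

      B-separates : ∀ i → Separates (Gap.ρ k M₁ i) A B
      B-separates i {a} {a′} {b} {b′} a∈ a′∈ b∈ b′∈ a≉a′ b≉b′ ρ[a-a′]≈b′-b
        with Membershipₚ.∈-map⁻ setoid setoid b∈ | Membershipₚ.∈-map⁻ setoid setoid b′∈
      ... | y , y∈ , b≈ | y′ , y′∈ , b′≈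
        with reciprocal-difference y∈ y′∈ (λ y≈y′ → b≉b′ (≈-trans b≈ (≈-trans (inv-cong y≈y′) (≈-sym b′≈))))
      ... | u , u∈ , S[b′-b]u = Gap.ρ-avoids k M₁ M₁-bound i (cosetUnion-* (A-differences a∈ a′∈ a≉a′) u∈) S[b′-b]u (begin
        Gap.ρ k M₁ i * ((a - a′) * u)      ≈⟨ *-assoc _ _ _ ⟨
        Gap.ρ k M₁ i * (a - a′) * u        ≈⟨ *-congʳ ρ[a-a′]≈b′-b ⟩
        (b′ - b) * u                       ≈⟨ *-congʳ (+-cong b′≈ (-‿cong b≈)) ⟩
        (inv y′ - inv y) * u               ∎)

      e-A : ∀ n → 0 < n → n ℕ.* q < M₀ ℕ.* |H| → e n A ≈ 0#
      e-A = separates⇒e≈0 A! A! |A| |A| (Gap.ρ k M₀) (Gap.ρ-injective k M₀ (k+M<d M₀-bound)) (Gap.ρ≉0 k M₀)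
              (differences⇒separates M₀-bound A-differences) (M*|H|≤N M₀-bound)

      e-B : ∀ n → 0 < n → n ℕ.* q < M₁ ℕ.* |H| → e n B ≈ 0#
      e-B = separates⇒e≈0 A! B! |A| |B| (Gap.ρ k M₁) (Gap.ρ-injective k M₁ (k+M<d M₁-bound)) (Gap.ρ≉0 k M₁)
              B-separates (M*|H|≤N M₁-bound)

      0∉tail : All (0# ≉_) tail
      0∉tail with A!
      ... | x₀-x₀∉tail ∷ _ = All.map (λ x₀-x₀≉ 0≈ → x₀-x₀≉ (≈-trans (-‿inverseʳ x₀) 0≈)) x₀-x₀∉tail

      e-A-tail : ∀ n → e n A ≈ e n tail
      e-A-tail n = e-0∷ n tail (-‿inverseʳ x₀)

      e-A-middle : ∀ n → 0 < n → n ≤ m → e n A ≈ 0#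
      e-A-middle n 0<n n≤m = [ e-A n 0<n , from-B ]′ (sum-<⇒⊎-< n n′ M₀ M₁
        (subst (λ l → l ℕ.* q < (M₀ ℕ.+ M₁) ℕ.* |H|) (≡.sym (ℕ.m+[n∸m]≡n (ℕ.m≤n⇒m≤1+n n≤m))) [1+m]*q<[M₀+M₁]*|H|))
        where
        n′ : ℕ
        n′ = suc m ℕ.∸ n
        from-B : n′ ℕ.* q < M₁ ℕ.* |H| → e n A ≈ 0#
        from-B n′< = begin
          e n A                                           ≈⟨ e-A-tail n ⟩
          e n tail                                        ≈⟨ e-reciprocal (inverses 0∉tail) n′ n (≡.trans (ℕ.m∸n+n≡m (ℕ.m≤n⇒m≤1+n n≤m)) (≡.sym |tail|)) ⟨
          -- The head of B is the inverse of x₀ - x₀ = 0, which is 0 by convention, so it does not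
          -- affect the symmetric functions.
          e (length tail) tail * e n′ (map inv tail)      ≈⟨ *-congˡ (e-0∷ n′ (map inv tail) (inv-0 (-‿inverseʳ x₀))) ⟨
          e (length tail) tail * e n′ B                   ≈⟨ *-congˡ (e-B n′ (ℕ.m<n⇒0<n∸m (s≤s n≤m)) n′<) ⟩
          e (length tail) tail * 0#                       ≈⟨ zeroʳ _ ⟩
          0#                                              ∎

      -- The product of all w + a′ is evaluated at w = - a, where one factor vanishes. Its constant
      -- term is the product of the elements of A, one of which is 0.
      A-equation : ∀ {a} → a ∈ A → (- a) ^ q + e (suc m) A * - a ≈ 0#
      A-equation {a} a∈ = begin
        (- a) ^ q + e (suc m) A * - a               ≈⟨ +-identityʳ _ ⟨
        (- a) ^ q + e (suc m) A * - a + 0#          ≈⟨ +-congˡ (≈-trans (e-A-tail q) (e-overflow q tail (s≤s (ℕ.≤-reflexive |tail|)))) ⟨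
        (- a) ^ q + e (suc m) A * - a + e q A       ≈⟨ ∏-sparse (- a) A m |A| e-A-middle ⟨
        ∏ (map (- a +_) A)                          ≈⟨ ∏-zero (Any.map (λ a≈x → ≈-trans (+-congˡ (≈-sym a≈x)) (-‿inverseˡ a)) a∈) ⟩
        0#                                          ∎

      y₁ : Carrier
      y₁ = x₁ - x₀

      y₁∈A : y₁ ∈ A
      y₁∈A = there (here ≈-refl)

      y₁≉0 : y₁ ≉ 0#
      y₁≉0 = All.head 0∉tail ∘ ≈-sym

      -- Multiply the equation of y₁ by u and compare it with the equation of y₁u: the linear terms
      -- agree, and what remains is u^q = u.
      quotient∈K : ∀ {u} → y₁ * u ∈ A → K u
      quotient∈K {u} y₁u∈A = ^q≈⇒K (*-cancelˡ (^≉0 q -y₁≉0) (+-cancelʳ (C₁ * (- y₁ * u)) _ _ (begin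
        (- y₁) ^ q * u ^ q + C₁ * (- y₁ * u)     ≈⟨ +-congʳ (^-distrib-* (- y₁) u q) ⟨
        (- y₁ * u) ^ q + C₁ * (- y₁ * u)         ≈⟨ +-cong (^-congˡ q (-‿distribˡ-* y₁ u)) (*-congˡ (-‿distribˡ-* y₁ u)) ⟨
        (- (y₁ * u)) ^ q + C₁ * - (y₁ * u)       ≈⟨ A-equation y₁u∈A ⟩
        0#                                       ≈⟨ zeroˡ u ⟨
        0# * u                                   ≈⟨ *-congʳ (A-equation y₁∈A) ⟨
        ((- y₁) ^ q + C₁ * - y₁) * u             ≈⟨ solve 4 (λ P B Y U → (P :+ B :* Y) :* U := P :* U :+ B :* (Y :* U)) ≈-refl ((- y₁) ^ q) C₁ (- y₁) u ⟩
        (- y₁) ^ q * u + C₁ * (- y₁ * u)         ∎)))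
        where
        C₁ : Carrier
        C₁ = e (suc m) A
        -y₁≉0 : - y₁ ≉ 0#
        -y₁≉0 -y₁≈0 = y₁≉0 (≈-trans (≈-sym (-‿involutive y₁)) (≈-trans (-‿cong -y₁≈0) -0#≈0#))

      clique⊆line : ∀ {x} → x ∈ (x₀ ∷ x₁ ∷ xs) → affine y₁ K x₀ x
      clique⊆line {x} x∈ = inv y₁ * (x - x₀) , quotient∈K (Membershipₚ.∈-resp-≈ setoid (≈-sym y₁u≈) (Membershipₚ.∈-map⁺ setoid setoid +-congʳ x∈)) , (begin
        x                                        ≈⟨ +-identityʳ x ⟨
        x + 0#                                   ≈⟨ +-congˡ (-‿inverseˡ x₀) ⟨
        x + (- x₀ + x₀)                          ≈⟨ +-assoc _ _ _ ⟨
        x - x₀ + x₀                              ≈⟨ +-congʳ y₁u≈ ⟨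
        y₁ * (inv y₁ * (x - x₀)) + x₀            ∎)
        where
        y₁u≈ : y₁ * (inv y₁ * (x - x₀)) ≈ x - x₀
        y₁u≈ = ≈-trans (≈-sym (*-assoc _ _ _)) (≈-trans (*-congʳ (*-inv y₁≉0)) (*-identityˡ _))

      line⊆clique : ∀ {x} → affine y₁ K x₀ x → x ∈ (x₀ ∷ x₁ ∷ xs)
      line⊆clique {x} (u , Ku , x≈) = ∈-resp-↭ (↭-sym clique↭line)
        (Membershipₚ.∈-resp-≈ setoid (≈-sym x≈) (Membershipₚ.∈-map⁺ setoid setoid line-cong (K⇒∈ Ku)))
        where
        line-cong : ∀ {u v} → u ≈ v → y₁ * u + x₀ ≈ y₁ * v + x₀
        line-cong u≈v = +-congʳ (*-congˡ u≈v)
        clique↭line : x₀ ∷ x₁ ∷ xs ↭ map (λ u → y₁ * u + x₀) K-elements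
        clique↭line = unique∧⊆⇒↭ (proj₁ clique)
          (λ y∈ → let v , Kv , y≈ = clique⊆line y∈ in
            Membershipₚ.∈-resp-≈ setoid (≈-sym y≈) (Membershipₚ.∈-map⁺ setoid setoid line-cong (K⇒∈ Kv)))
          (ℕ.≤-reflexive (≡.trans (List.length-map (λ u → y₁ * u + x₀) K-elements) (≡.trans |K-elements| (cong (2 ℕ.+_) (≡.sym |xs|≡m)))))

    clique≐line : ∀ xs → IsClique xs → length xs ≡ q → ∃[ a ] ∃[ b ] S a × (_∈ xs) ≐ affine a K b
    clique≐line (x₀ ∷ x₁ ∷ xs) clique |xs| = L.y₁ , x₀ , L.A-nonzero⇒S L.y₁∈A L.y₁≉0 , L.clique⊆line , L.line⊆clique
      where module L = Line x₀ x₁ xs (ℕ.suc-injective (ℕ.suc-injective |xs|)) clique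

    -- Cliques of size q and divisibility of q + 1 by d

    -- For x = g^t the relation x^(q - 1) = 1 makes (q - 1)(q + 1) divide t(q - 1). So q + 1, and
    -- with it d, divides t.
    K⇒H : d ∣ suc q → ∀ {x} → K x → x ≉ 0# → H x
    K⇒H d∣1+q {x} Kx x≉0 = let t , x≈gᵗ = log x x≉0 in g^t∈H t x≈gᵗ
      where
      g^t∈H : ∀ t → x ≈ g ^ t → H x
      g^t∈H t x≈gᵗ = d∣t⇒H (∣-trans d∣1+q (*-cancelˡ-∣ (suc m)
        (subst₂ _∣_ N≡[1+m]*[1+q] (ℕ.*-comm t (suc m)) (g^n≈1⇒N∣n (t ℕ.* suc m)
          (≈-trans (≈-sym (^-assocʳ g t (suc m))) (≈-trans (^-congˡ (suc m) (≈-sym x≈gᵗ)) (K⇒^≈1 Kx x≉0)))))))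
        where
        d∣t⇒H : d ∣ t → H x
        d∣t⇒H (divides s t≡s*d) = H-resp (≈-trans (^-assocʳ g d s)
          (≈-trans (^-congʳ g (≡.trans (ℕ.*-comm d s) (≡.sym t≡s*d))) (≈-sym x≈gᵗ))) (H-^ s g^d∈H)

    K-clique : d ∣ suc q → IsClique K-elements
    K-clique d∣1+q = K-elements! , λ x∈ y∈ x≉y → 0 , z≤n ,
      H⇒coset-0 (K⇒H d∣1+q (K-+ (∈⇒K x∈) (K-neg (∈⇒K y∈))) (λ x-y≈0 → x≉y (x∙y⁻¹≈ε⇒x≈y _ _ x-y≈0)))

    -- The element u₀ = g^(q+1) of K lies in g^ρH, where ρ is the residue of q + 1 modulo d.  Multiplication by u₀
    -- preserves aK ∖ {0} ⊆ S, yet if ρ ≠ 0 then iterating it leaves the interval of residues 0, …, k.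
    module LineInS (a : Carrier) (Sa : S a) (aK⊆S : ∀ u → K u → u ≉ 0# → S (a * u)) where

      ρ : ℕ
      ρ = suc q % d

      u₀ : Carrier
      u₀ = g ^ suc q

      u₀≉0 : u₀ ≉ 0#
      u₀≉0 = ^≉0 (suc q) g≉0

      Ku₀ : K u₀
      Ku₀ = ^q≈⇒K (^≈1⇒^q≈ (≈-trans (^-assocʳ g (suc q) (suc m))
        (≈-trans (^-congʳ g (≡.trans (ℕ.*-comm (suc q) (suc m)) (≡.sym N≡[1+m]*[1+q]))) g^N≈1)))

      step-coset : ∀ n v → (g ^ n · H) (a * v) → (g ^ (n ℕ.+ ρ) · H) (a * (v * u₀))
      step-coset n v av∈ = coset-resp (n ℕ.+ ρ) (*-assoc a v u₀) (coset-* n ρ av∈ (coset-% d₁ (suc q) g^d∈H ≈-refl))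

      step-≤k : ∀ n v → K v → v ≉ 0# → n < d → (g ^ n · H) (a * v) → n ≤ k
      step-≤k n v Kv v≉0 n<d av∈ = let j , j≤k , av∈′ = aK⊆S v Kv v≉0 in
        subst (_≤ k) (coset-unique j n (ℕ.≤-<-trans j≤k k<d) n<d av∈′ av∈) j≤k

      Orbit : ℕ → Set _
      Orbit n = ∃[ v ] K v × v ≉ 0# × (g ^ n · H) (a * v)

      initial : ∃[ n ] n ≤ k × Orbit n
      initial = let j , j≤k , a∈ = Sa in j , j≤k , 1# , 1∈K , 1≉0 , coset-resp j (≈-sym (*-identityʳ a)) a∈

      advance : ∀ n → Orbit n → Orbit (n ℕ.+ ρ)
      advance n (v , Kv , v≉0 , av∈) = v * u₀ , K-* Kv Ku₀ , x*y≉0 v≉0 u₀≉0 , step-coset n v av∈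

      orbit-≤k : ∀ n → n < d → Orbit n → n ≤ k
      orbit-≤k n n<d (v , Kv , v≉0 , av∈) = step-≤k n v Kv v≉0 n<d av∈

      -- Both n and ρ are at most k, so n + ρ < d is itself a residue and again at most k. Since ρ >
      -- 0, the residue nevertheless grows without bound.
      ascend : 0 < ρ → ρ ≤ k → ∀ i → ∃[ n ] i ≤ n × n ≤ k × Orbit n
      ascend 0<ρ ρ≤k zero    = let n , n≤k , o = initial in n , z≤n , n≤k , o
      ascend 0<ρ ρ≤k (suc i) = let n , i≤n , n≤k , o = ascend 0<ρ ρ≤k i in
        n ℕ.+ ρ , ℕ.≤-trans (ℕ.≤-reflexive (ℕ.+-comm 1 i)) (ℕ.+-mono-≤ i≤n 0<ρ) ,
        orbit-≤k (n ℕ.+ ρ) (ℕ.≤-<-trans (ℕ.+-mono-≤ n≤k ρ≤k) 2k<d) (advance n o) , advance n o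

      -- A value n + ρ below d would be a residue exceeding k. Every step therefore wraps around and
      -- lowers n by d - ρ > 0; `f` bounds the length of this descent.
      descend : k < ρ → ∀ f n → n < f → ¬ Orbit n
      descend k<ρ (suc f) n n<1+f o with n ℕ.+ ρ ℕ.<? d
      ... | yes n+ρ<d = ℕ.<⇒≱ k<ρ (ℕ.≤-trans (ℕ.m≤n+m ρ n) (orbit-≤k (n ℕ.+ ρ) n+ρ<d (advance n o)))
      ... | no n+ρ≮d = descend k<ρ f n′ (ℕ.<-≤-trans n′<n (s≤s⁻¹ n<1+f)) (drop-d (advance n o))
        where
        n′ : ℕ
        n′ = n ℕ.+ ρ ℕ.∸ d
        d+n′≡n+ρ : d ℕ.+ n′ ≡ n ℕ.+ ρ
        d+n′≡n+ρ = ℕ.m+[n∸m]≡n (ℕ.≮⇒≥ n+ρ≮d)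
        n′<n : n′ < n
        n′<n = ℕ.+-cancelˡ-< d n′ n (ℕ.≤-<-trans (ℕ.≤-reflexive d+n′≡n+ρ)
          (ℕ.<-≤-trans (ℕ.+-monoʳ-< n (m%n<n (suc q) d)) (ℕ.≤-reflexive (ℕ.+-comm n d))))
        drop-d : Orbit (n ℕ.+ ρ) → Orbit n′
        drop-d (v , Kv , v≉0 , av∈) = v , Kv , v≉0 , coset-drop-d n′ (subst (λ l → (g ^ l · H) (a * v)) (≡.sym d+n′≡n+ρ) av∈)

      ρ≡0 : ρ ≡ 0
      ρ≡0 with ρ ℕ.≟ 0 | ρ ℕ.≤? k
      ... | yes ρ≡0 | _       = ρ≡0
      ... | no ρ≢0  | yes ρ≤k = let n , k<n , n≤k , _ = ascend (ℕ.n≢0⇒n>0 ρ≢0) ρ≤k (suc k) in contradiction n≤k (ℕ.<⇒≱ k<n)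
      ... | no ρ≢0  | no ρ≰k  = let n , n≤k , o = initial in contradiction o (descend (ℕ.≰⇒> ρ≰k) (suc n) n ℕ.≤-refl)

      d∣1+q : d ∣ suc q
      d∣1+q = m%n≡0⇒n∣m (suc q) d ρ≡0

    clique⇒d∣1+q : ∀ xs → IsClique xs → length xs ≡ q → d ∣ suc q
    clique⇒d∣1+q xs (xs! , adjacent) |xs| with clique≐line xs (xs! , adjacent) |xs|
    -- Both b and au + b belong to the clique, and their difference au is thereby in S.
    ... | a , b , Sa , xs⊆ , ⊆xs = LineInS.d∣1+q a Sa λ u Ku u≉0 →
      cosetUnion-resp (b+au-b u) (adjacent (⊆xs (u , Ku , ≈-refl)) (⊆xs (0# , 0∈K , ≈-sym (≈-trans (+-congʳ (zeroʳ a)) (+-identityˡ b))))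
        (λ au+b≈b → x*y≉0 (cosetUnion-≉0 Sa) u≉0 (+-cancelʳ b _ _ (≈-trans au+b≈b (≈-sym (+-identityˡ b))))))
      where
      b+au-b : ∀ u → a * u + b - b ≈ a * u
      b+au-b u = ≈-trans (+-assoc _ _ _) (≈-trans (+-congˡ (-‿inverseʳ b)) (+-identityʳ _))

-- Existence of the clique number by exhaustive search

module CliqueSearch {a ℓ r} (V : Setoid a ℓ) {n} (size : HasSize V n) (_~_ : Rel (Setoid.Carrier V) r)
  (~-resp : ∀ {x x′ y y′} → Setoid._≈_ V x x′ → Setoid._≈_ V y y′ → x ~ y → x′ ~ y′) (_~?_ : Decidable _~_) where

  open Setoid V renaming (refl to ≈-refl; sym to ≈-sym; trans to ≈-trans)
  open Membership V using (_∈_)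
  open UniqueLists V
  open Finite size
  open Cliques V _~_

  -- Both directions are recorded, because `AllPairs` meets each pair once while a clique is asked
  -- about it in either order.
  Edge : Rel Carrier (ℓ ⊔ r)
  Edge x y = x ≉ y × x ~ y × y ~ x

  Edge-resp : ∀ {x x′ y y′} → x ≈ x′ → y ≈ y′ → Edge x y → Edge x′ y′
  Edge-resp x≈x′ y≈y′ (x≉y , x~y , y~x) =
    (λ x′≈y′ → x≉y (≈-trans x≈x′ (≈-trans x′≈y′ (≈-sym y≈y′)))) , ~-resp x≈x′ y≈y′ x~y , ~-resp y≈y′ x≈x′ y~x

  Edge? : Decidable Edge
  Edge? x y = ¬? (x ≟ y) ×-dec (x ~? y) ×-dec (y ~? x)

  clique⇒edges : ∀ {xs} → IsClique xs → AllPairs Edge xs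
  clique⇒edges {[]}     _ = []
  clique⇒edges {x ∷ xs} (x∉xs ∷ xs! , adjacent) =
    All.tabulateₛ V (λ {y} y∈xs → let x≉y = x≉ y∈xs in x≉y , adjacent (here ≈-refl) (there y∈xs) x≉y , adjacent (there y∈xs) (here ≈-refl) (x≉y ∘ ≈-sym)) ∷
    clique⇒edges (xs! , λ y∈ z∈ → adjacent (there y∈) (there z∈))
    where
    x≉ : ∀ {y} → y ∈ xs → x ≉ y
    x≉ = All.lookupₛ V (λ y≈z x≉y x≈z → x≉y (≈-trans x≈z (≈-sym y≈z))) x∉xs

  edges⇒clique : ∀ {xs} → AllPairs Edge xs → IsClique xs
  edges⇒clique edges = AllPairs.map proj₁ edges , adjacent edges
    where
    lookupEdge : ∀ {x y xs} → All.All (Edge x) xs → y ∈ xs → Edge x y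
    lookupEdge es y∈xs = All.lookupₛ V (Edge-resp ≈-refl) es y∈xs
    adjacent : ∀ {xs} → AllPairs Edge xs → ∀ {x y} → x ∈ xs → y ∈ xs → x ≉ y → x ~ y
    adjacent (_ ∷ _)  (here x≈)  (here y≈)  x≉y = contradiction (≈-trans x≈ (≈-sym y≈)) x≉y
    adjacent (es ∷ _) (here x≈)  (there y∈) x≉y = ~-resp (≈-sym x≈) ≈-refl (proj₁ (proj₂ (lookupEdge es y∈)))
    adjacent (es ∷ _) (there x∈) (here y≈)  x≉y = ~-resp ≈-refl (≈-sym y≈) (proj₂ (proj₂ (lookupEdge es x∈)))
    adjacent (_ ∷ es) (there x∈) (there y∈) x≉y = adjacent es x∈ y∈ x≉y

  search : ∀ {p} {P : Pred (List (Fin n)) p} → Unary.Decidable P → ∀ l → Dec (∃[ is ] length is ≡ l × P is)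
  search P? zero    = map′ (λ p → [] , ≡.refl , p) (λ { ([] , _ , p) → p }) (P? [])
  search P? (suc l) = map′ (λ { (i , is , |is| , p) → i ∷ is , cong suc |is| , p })
    (λ { (i ∷ is , |is| , p) → i , is , ℕ.suc-injective |is| , p })
    (Fin.any? (λ i → search (P? ∘ (i ∷_)) l))

  cliqueOfLength? : ∀ l → Dec (∃[ xs ] length xs ≡ l × IsClique xs)
  cliqueOfLength? l = map′
    (λ { (is , |is| , es) → map from is , ≡.trans (List.length-map from is) |is| , edges⇒clique (AllPairsₚ.map⁺ es) })
    (λ { (xs , |xs| , cl) → map to xs , ≡.trans (List.length-map to xs) |xs| ,
         AllPairsₚ.map⁺ (AllPairs.map (Edge-resp (≈-sym (from-to _)) (≈-sym (from-to _))) (clique⇒edges cl)) })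
    (search (AllPairs.allPairs? (λ i j → Edge? (from i) (from j))) l)

  -- Descent on the bound: if no clique has exactly b elements, b - 1 is a bound as well. The empty
  -- list is a clique, so the descent ends at 0 at the latest.
  cliqueNumber : ∀ b → (∀ xs → IsClique xs → length xs ≤ b) → ∃[ w ] IsCliqueNumber w × w ≤ b
  cliqueNumber b bound with cliqueOfLength? b
  ... | yes (xs , |xs| , cl) = b , (xs , (cl , λ ys cl′ → ℕ.≤-trans (bound ys cl′) (ℕ.≤-reflexive (≡.sym |xs|))) , |xs|) , ℕ.≤-refl
  cliqueNumber zero    bound | no ∄ = contradiction ([] , ≡.refl , edges⇒clique []) ∄
  cliqueNumber (suc b) bound | no ∄ =
    let w , isω , w≤b = cliqueNumber b λ xs cl → s≤s⁻¹ (ℕ.≤∧≢⇒< (bound xs cl) λ |xs| → ∄ (xs , |xs| , cl))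
    in w , isω , ℕ.m≤n⇒m≤1+n w≤b

1<p^n : ∀ {p} → Prime p → ∀ n → 1 ≤ n → 1 < p ℕ.^ n
1<p^n {p} pr n@(suc _) 1≤n = ℕ.<-≤-trans (ℕ.nonTrivial⇒n>1 p {{prime⇒nonTrivial pr}})
  (ℕ.≤-trans (ℕ.≤-reflexive (≡.sym (ℕ.^-identityʳ p))) (ℕ.^-monoʳ-≤ p {{ℕ.nonTrivial⇒nonZero p {{prime⇒nonTrivial pr}}}} 1≤n))

open import Data.Nat.Base using (_+_; _*_; _∸_; _≥_)

-- Assembly for q = 2 + m

module Theorem {c ℓ₁ ℓ₂ κ h} (F : HeytingField c ℓ₁ ℓ₂)
  (m : ℕ) (q-primePower : IsPrimePower (2 + m)) (size : HasSize (FieldNotions.setoid F) ((2 + m) ℕ.^ 2))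
  (K : Pred (FieldNotions.Carrier F) κ) (K-subfield : FieldNotions.IsSubfield F K)
  (K-size : HasSize (subsetoid (FieldNotions.setoid F) K) (2 + m))
  (H : Pred (FieldNotions.Carrier F) h) (H-subgroup : FieldNotions.IsSubgroup* F H)
  (d₁ : ℕ) (index : FieldNotions.HasIndex* F H (suc d₁))
  (k r : ℕ) (d≡6k+2+r : suc d₁ ≡ 6 * k + 2 + r)
  (g : FieldNotions.Carrier F) (g-generator : FieldNotions.IsGenerator* F g)
  where

  open FieldNotions F

  private
    q N d : ℕ
    q = 2 + m
    -- In this form `suc N` computes to `q * q`.
    N = suc m + suc m * q
    d = suc d₁

    q^2≡1+N : q ℕ.^ 2 ≡ suc N
    q^2≡1+N = cong (q *_) (ℕ.*-identityʳ q)

    size′ : HasSize setoid (suc N)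
    size′ = subst (HasSize setoid) q^2≡1+N size

    module C = Cosets F N size′ H H-subgroup d₁ index g g-generator

    p n : ℕ
    p = proj₁ q-primePower
    n = proj₁ (proj₂ q-primePower)

    p-prime : Prime p
    p-prime = proj₁ (proj₂ (proj₂ q-primePower))

    q≡pⁿ : q ≡ p ℕ.^ n
    q≡pⁿ = proj₂ (proj₂ (proj₂ (proj₂ q-primePower)))

    1+N≡p^[n*2] : suc N ≡ p ℕ.^ (n * 2)
    1+N≡p^[n*2] = ≡.trans (≡.sym q^2≡1+N) (≡.trans (cong (ℕ._^ 2) q≡pⁿ) (ℕ.^-*-assoc p n 2))

    p∣qCi : ∀ i → 0 < i → i < q → p ∣ (q C i)
    p∣qCi i 0<i i<q = subst (λ q → p ∣ (q C i)) (≡.sym q≡pⁿ) (p∣p^aCi p-prime n i 0<i (subst (i <_) q≡pⁿ i<q))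

    module L = C.LargeCliques k r d≡6k+2+r m ≡.refl
      (λ i 0<i i<q → C.∣⇒×≈0 (C.characteristic p (n * 2) 1+N≡p^[n*2]) (p∣qCi i 0<i i<q)) K K-subfield K-size

  S : Pred Carrier (c ⊔ ℓ₁ ⊔ h)
  S = cosetUnion g H k

  open Cliques setoid (Cay +-abelianGroup S)

  cliqueNumber≡q : d ∣ suc q → IsCliqueNumber q
  cliqueNumber≡q d∣1+q = L.K-elements , (L.K-clique d∣1+q , λ ys cl → ℕ.≤-trans (L.clique⇒length≤q cl) (ℕ.≤-reflexive (≡.sym L.|K-elements|))) , L.|K-elements|

  maximumClique≐line : d ∣ suc q → ∀ xs → IsMaximumClique xs → ∃[ a ] ∃[ b ] S a × (_∈ xs) ≐ affine a K b
  maximumClique≐line d∣1+q xs (cl , maximum) = L.clique≐line xs cl (ℕ.≤-antisym (L.clique⇒length≤q cl)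
    (ℕ.≤-trans (ℕ.≤-reflexive (≡.sym L.|K-elements|)) (maximum L.K-elements (L.K-clique d∣1+q))))

  cliqueNumber<q : ¬ d ∣ suc q → ∃[ w ] IsCliqueNumber w × w ≤ suc m
  cliqueNumber<q d∤1+q = Search.cliqueNumber (suc m) λ xs cl →
    s≤s⁻¹ (ℕ.≤∧≢⇒< (L.clique⇒length≤q cl) λ |xs| → d∤1+q (L.clique⇒d∣1+q xs cl |xs|))
    where
    open CommutativeRing commutativeRing using (_-_; +-cong; -‿cong)
    module Search = CliqueSearch setoid size (Cay +-abelianGroup S)
      (λ {x} {x′} {y} {y′} x≈x′ y≈y′ → C.cosetUnion-resp {k} {x - y} {x′ - y′} (+-cong x≈x′ (-‿cong y≈y′)))
      (λ x y → C.cosetUnion? L.k<d (x - y))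

theorem1p4 :
    ∀ {c ℓ₁ ℓ₂ κ h} (q : ℕ) → IsPrimePower q →
    (F : HeytingField c ℓ₁ ℓ₂) → let open FieldNotions F in
    HasSize setoid (q ℕ.^ 2) →
    (𝔽q : Pred Carrier κ) → IsSubfield 𝔽q → HasSize (subsetoid setoid 𝔽q) q →
    (H : Pred Carrier h) → IsSubgroup* H →
    (d : ℕ) → HasIndex* H d → d ≥ 2 →
    (k : ℕ) (g : Carrier) → IsGenerator* g →
    let S = cosetUnion g H k in
    S ≐ neg S →
    let open Cliques setoid (Cay +-abelianGroup S) in
    (d ∣ q + 1 → d ≥ 6 * k + 2 →
    IsCliqueNumber q ×
    (∀ xs → IsMaximumClique xs →
    ∃[ a ] ∃[ b ] S a × (_∈ xs) ≐ affine a 𝔽q b))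
    ×
    (d ∤ q + 1 → d ≥ 12 * k + 3 → q ℕ.^ 2 ∸ 1 ≥ 2 * d →
    ∃[ w ] IsCliqueNumber w × w ≤ q ∸ 1)
theorem1p4 0 (p , n , pr , 1≤n , 0≡pⁿ) = contradiction (subst (1 <_) (≡.sym 0≡pⁿ) (1<p^n pr n 1≤n)) λ ()
theorem1p4 1 (p , n , pr , 1≤n , 1≡pⁿ) = contradiction (subst (1 <_) (≡.sym 1≡pⁿ) (1<p^n pr n 1≤n)) (ℕ.<-irrefl ≡.refl)
theorem1p4 (suc (suc m)) q-primePower F size 𝔽q 𝔽q-subfield 𝔽q-size H H-subgroup (suc d₁) index _ k g g-generator _ =
  (λ d∣q+1 d≥6k+2 → T.cliqueNumber≡q d≥6k+2 (d∣1+q d∣q+1) , T.maximumClique≐line d≥6k+2 (d∣1+q d∣q+1)) ,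
  -- Termwise 12k + 3 ≥ 6k + 2, so the classification of cliques with q elements applies here as
  -- well.
  (λ d∤q+1 d≥12k+3 _ → T.cliqueNumber<q (ℕ.≤-trans (ℕ.+-mono-≤ (ℕ.*-monoˡ-≤ k (ℕ.m≤m+n 6 6)) (ℕ.m≤m+n 2 1)) d≥12k+3)
    (d∤q+1 ∘ subst (suc d₁ ∣_) (≡.sym (ℕ.+-comm (2 + m) 1))))
  where
  module T (d≥6k+2 : suc d₁ ≥ 6 * k + 2) = Theorem F m q-primePower size 𝔽q 𝔽q-subfield 𝔽q-size H H-subgroup d₁ index
    k (suc d₁ ∸ (6 * k + 2)) (≡.sym (ℕ.m+[n∸m]≡n d≥6k+2)) g g-generator
  d∣1+q : suc d₁ ∣ 2 + m + 1 → suc d₁ ∣ 3 + m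
  d∣1+q = subst (suc d₁ ∣_) (ℕ.+-comm (2 + m) 1)
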